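{- The problem CUTTING INTO $l$ COMPONENTS is W[1]-hard with parameters $k$ and $l$ when restricted to balanced 2-track interval graphs, and also when restricted to co-balanced 3-track interval graphs (complements of balanced 3-track interval graphs).
   Context: CUTTING INTO $l$ COMPONENTS: given a graph $H$ and two integers $k$ and $l$, decide whether one can delete at most $k$ vertices from $H$ such that the remaining graph has at least $l$ connected components. "With parameters $k$ and $l$" means that the pair $(k,l)$ is the parameter. The intersection graph of a family of sets has one vertex per member, two different members being adjacent iff they intersect; the family is a representation of the graph. A $t$-track interval is the union of $t$ intervals on $t$ disjoint parallel lines (tracks), one interval on each track. A balanced $t$-track interval graph is the intersection graph of a family of $t$-track intervals in which the $t$ intervals of each $t$-track interval have the same length (intervals from different $t$-track intervals may have different lengths). Such a representation (of $H$, resp. of the complement of $H$) is given as part of the input. A parameterized problem is W[1]-hard if every problem in W[1] has an FPT reduction to it; equivalently, if $k$-CLIQUE in general graphs (parameter $k$) has an FPT reduction to it. An FPT reduction maps an instance $x$ with parameter $\kappa$ to an equivalent instance $x'$ with parameter $\kappa'$ in time $g(\kappa)\cdot|x|^{O(1)}$, with $\kappa'$ bounded by a function of $\kappa$ (all functions computable). -}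

module Defs where

open import Data.Bool.Base using (Bool; true; false; not; _∧_; T; if_then_else_)
open import Data.Bool.Properties using (∧-zeroʳ)
open import Data.Fin.Base using (Fin; zero; suc)
open import Data.Fin.Properties using (_≟_)
open import Data.Fin.Subset using (Subset; _∈_; _∉_; ∣_∣)
open import Data.Integer.Base as ℤ using (ℤ; +_; 0ℤ; 1ℤ)
open import Data.Nat.Base using (ℕ; zero; suc; _+_; _*_; _^_; _≤_)
open import Data.Nat.Logarithm using (⌈log₂_⌉)
open import Data.Product.Base using (∃; ∃₂; _×_; _,_)
open import Data.Vec.Base using (Vec; []; _∷_; lookup; replicate; _[_]≔_)
open import Function.Base using (_∘_)
open import Function.Bundles using (_⇔_)
open import Function.Definitions using (Injective)
open import Relation.Binary.Construct.Closure.ReflexiveTransitive using (Star)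
open import Relation.Binary.PropositionalEquality
  using (_≡_; _≢_; refl; sym; trans; cong; cong₂)
open import Relation.Nullary.Decidable using (⌊_⌋; yes; no)
open import Relation.Nullary.Negation using (¬_; contradiction)

-- A structured register machine with logarithmic cost.  Registers hold
-- binary trees with integer leaves; every evaluation of a subexpression is
-- charged the bit size of the value it produces, so running time agrees with
-- Turing machine time up to a polynomial, and the programs compute exactly
-- the Turing computable functions.

data Val : Set where
  int  : ℤ → Val
  pair : Val → Val → Val

nil : Val
nil = int 0ℤ

-- ⌈log₂ (1 + ∣i∣)⌉ is the number of binary digits of ∣i∣.
size : Val → ℕ
size (int i)    = suc ⌈log₂ suc ℤ.∣ i ∣ ⌉
size (pair u v) = suc (size u + size v)

data Expr (m : ℕ) : Set where
  var           : Fin m → Expr m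
  lit           : ℤ → Expr m
  cons          : Expr m → Expr m → Expr m
  hd tl isPair  : Expr m → Expr m
  add sub mul   : Expr m → Expr m → Expr m
  leq           : Expr m → Expr m → Expr m

infixr 5 _⨾_
infix  6 _:=_

data Code (m : ℕ) : Set where
  skip  : Code m
  _:=_  : Fin m → Expr m → Code m
  _⨾_   : Code m → Code m → Code m
  cond  : Expr m → Code m → Code m → Code m
  while : Expr m → Code m → Code m

Store : ℕ → Set
Store = Vec Val

toℤ : Val → ℤ
toℤ (int i)    = i
toℤ (pair _ _) = 0ℤ

fst snd : Val → Val
fst (int _)    = nil
fst (pair u _) = u
snd (int _)    = nil
snd (pair _ v) = v

fromBool : Bool → Val
fromBool b = int (if b then 1ℤ else 0ℤ)

pair? : Val → Bool
pair? (int _)    = false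
pair? (pair _ _) = true

truthy : Val → Bool
truthy (int (+ 0)) = false
truthy _           = true

eval : ∀ {m} → Expr m → Store m → Val
eval (var x)    s = lookup s x
eval (lit i)    s = int i
eval (cons d e) s = pair (eval d s) (eval e s)
eval (hd e)     s = fst (eval e s)
eval (tl e)     s = snd (eval e s)
eval (isPair e) s = fromBool (pair? (eval e s))
eval (add d e)  s = int (toℤ (eval d s) ℤ.+ toℤ (eval e s))
eval (sub d e)  s = int (toℤ (eval d s) ℤ.- toℤ (eval e s))
eval (mul d e)  s = int (toℤ (eval d s) ℤ.* toℤ (eval e s))
eval (leq d e)  s = fromBool (toℤ (eval d s) ℤ.≤ᵇ toℤ (eval e s))

cost : ∀ {m} → Expr m → Store m → ℕ
subcost : ∀ {m} → Expr m → Store m → ℕ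

cost e s = size (eval e s) + subcost e s

subcost (var _)    s = 0
subcost (lit _)    s = 0
subcost (cons d e) s = cost d s + cost e s
subcost (hd e)     s = cost e s
subcost (tl e)     s = cost e s
subcost (isPair e) s = cost e s
subcost (add d e)  s = cost d s + cost e s
subcost (sub d e)  s = cost d s + cost e s
subcost (mul d e)  s = cost d s + cost e s
subcost (leq d e)  s = cost d s + cost e s

-- Exec c s s′ t : started in store s, the code c halts in store s′ after
-- time t.
data Exec {m : ℕ} : Code m → Store m → Store m → ℕ → Set where
  skip   : ∀ {s} → Exec skip s s 1
  assign : ∀ {s} x e → Exec (x := e) s (s [ x ]≔ eval e s) (suc (cost e s))
  seq    : ∀ {s s′ s″ c d t u} →
           Exec c s s′ t → Exec d s′ s″ u → Exec (c ⨾ d) s s″ (t + u)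
  then   : ∀ {s s′ e c d t} → truthy (eval e s) ≡ true →
           Exec c s s′ t → Exec (cond e c d) s s′ (suc (cost e s + t))
  else   : ∀ {s s′ e c d t} → truthy (eval e s) ≡ false →
           Exec d s s′ t → Exec (cond e c d) s s′ (suc (cost e s + t))
  stop   : ∀ {s e c} → truthy (eval e s) ≡ false →
           Exec (while e c) s s (suc (cost e s))
  loop   : ∀ {s s′ s″ e c t u} → truthy (eval e s) ≡ true →
           Exec c s s′ t → Exec (while e c) s′ s″ u →
           Exec (while e c) s s″ (suc (cost e s + (t + u)))

record Program : Set where
  field
    extra : ℕ
    code  : Code (suc extra)

-- Register zero carries the input and the output.
Runs : Program → Val → Val → ℕ → Set
Runs P x y t = ∃ λ s → Exec code (x ∷ replicate extra nil) (y ∷ s) t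
  where open Program P

encodeℕ : ℕ → Val
encodeℕ n = int (+ n)

-- The family f as the list f 0, f 1, …, terminated by nil.
encodeFamily : ∀ {n} → (Fin n → Val) → Val
encodeFamily {zero}  f = nil
encodeFamily {suc n} f = pair (f zero) (encodeFamily (f ∘ suc))

encodeParams : ∀ {p} → Vec ℕ p → Val
encodeParams v = encodeFamily (encodeℕ ∘ lookup v)

Computable : ∀ {p} → (Vec ℕ p → ℕ) → Set
Computable f =
  ∃ λ P → ∀ v → ∃ λ t → Runs P (encodeParams v) (encodeℕ (f v)) t

-- The parameter is a tuple of natural numbers.  Instances may carry proofs
-- (of promises on the input), which the encoding omits.
record ParameterizedProblem : Set₁ where
  field
    Instance : Set
    encode   : Instance → Val
    arity    : ℕ
    param    : Instance → Vec ℕ arity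
    Yes      : Instance → Set

record FPTReduction (A B : ParameterizedProblem) : Set where
  private
    module A = ParameterizedProblem A
    module B = ParameterizedProblem B
  field
    map      : A.Instance → B.Instance
    correct  : ∀ x → A.Yes x ⇔ B.Yes (map x)

    program  : Program
    g        : Vec ℕ A.arity → ℕ
    g-comp   : Computable g
    exponent : ℕ
    runs     : ∀ x → ∃ λ t →
               Runs program (A.encode x) (B.encode (map x)) t ×
               t ≤ g (A.param x) * size (A.encode x) ^ exponent

    h        : Vec ℕ A.arity → ℕ
    h-comp   : Computable h
    bounded  : ∀ x i → lookup (B.param (map x)) i ≤ h (A.param x)

record Graph (n : ℕ) : Set where
  field
    adj       : Fin n → Fin n → Bool
    symmetric : ∀ u v → adj u v ≡ adj v u
    loopless  : ∀ v → adj v v ≡ false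

  Adjacent : Fin n → Fin n → Set
  Adjacent u v = T (adj u v)

open Graph public using (Adjacent)

encodeGraph : ∀ {n} → Graph n → Val
encodeGraph G = encodeFamily λ u → encodeFamily λ v → fromBool (Graph.adj G u v)

complement : ∀ {n} → Graph n → Graph n
complement {n} G = record
  { adj       = λ u v → not (adj u v) ∧ not ⌊ u ≟ v ⌋
  ; symmetric = λ u v → cong₂ (λ a b → not a ∧ not b) (symmetric u v) (≟-sym u v)
  ; loopless  = λ v → trans (cong (λ b → not (adj v v) ∧ not b) (≟-refl v))
                            (∧-zeroʳ (not (adj v v)))
  }
  where
  open Graph G

  ≟-sym : (u v : Fin n) → ⌊ u ≟ v ⌋ ≡ ⌊ v ≟ u ⌋
  ≟-sym u v with u ≟ v | v ≟ u
  ... | yes _ | yes _ = refl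
  ... | no  _ | no  _ = refl
  ... | yes p | no ¬q = contradiction (sym p) ¬q
  ... | no ¬p | yes q = contradiction (sym q) ¬p

  ≟-refl : (v : Fin n) → ⌊ v ≟ v ⌋ ≡ true
  ≟-refl v with v ≟ v
  ... | yes _ = refl
  ... | no ¬p = contradiction refl ¬p

record CliqueInstance : Set where
  field
    {n}   : ℕ
    graph : Graph n
    k     : ℕ

IsClique : ∀ {n} → Graph n → Subset n → Set
IsClique G S = ∀ u v → u ∈ S → v ∈ S → u ≢ v → Adjacent G u v

k-Clique : ParameterizedProblem
k-Clique = record
  { Instance = CliqueInstance
  ; encode   = λ x → pair (encodeGraph (graph x)) (encodeℕ (k x))
  ; arity    = 1
  ; param    = λ x → k x ∷ []
  ; Yes      = λ x → ∃ λ S → ∣ S ∣ ≡ k x × IsClique (graph x) S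
  }
  where open CliqueInstance

-- k-Clique is W[1]-complete, and FPT reductions compose.
W[1]-Hard : ParameterizedProblem → Set
W[1]-Hard B = FPTReduction k-Clique B

EdgeAvoiding : ∀ {n} → Graph n → Subset n → Fin n → Fin n → Set
EdgeAvoiding H D u v = u ∉ D × v ∉ D × Adjacent H u v

-- C is the class of some remaining vertex under reachability in H - D.
IsComponent : ∀ {n} → Graph n → Subset n → Subset n → Set
IsComponent H D C =
  ∃ λ v → v ∉ D × (∀ w → w ∈ C ⇔ Star (EdgeAvoiding H D) v w)

AtLeastComponents : ∀ {n} → ℕ → Graph n → Subset n → Set
AtLeastComponents {n} l H D =
  ∃ λ (C : Fin l → Subset n) → Injective _≡_ _≡_ C × (∀ i → IsComponent H D (C i))

CanCut : ∀ {n} → Graph n → ℕ → ℕ → Set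
CanCut H k l = ∃ λ D → ∣ D ∣ ≤ k × AtLeastComponents l H D

-- Closed intervals.  Integer endpoints are no restriction: the conditions a
-- finite family of real intervals must satisfy to be a balanced
-- representation of a given graph are homogeneous linear with integer
-- coefficients, hence have an integer solution if they have a real one.
record Interval : Set where
  field
    lo hi : ℤ
    lo<hi : lo ℤ.< hi

  length : ℤ
  length = hi ℤ.- lo

TrackInterval : ℕ → Set
TrackInterval t = Fin t → Interval

-- The point p of track i lies in X.
Contains : ∀ {t} → TrackInterval t → Fin t → ℤ → Set
Contains X i p = lo ℤ.≤ p × p ℤ.≤ hi
  where open Interval (X i)

-- Closed intervals with integer endpoints that share a real point share an
-- integer one.
Intersect : ∀ {t} → TrackInterval t → TrackInterval t → Set
Intersect X Y = ∃₂ λ i p → Contains X i p × Contains Y i p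

Balanced : ∀ {t} → TrackInterval t → Set
Balanced X = ∀ i j → Interval.length (X i) ≡ Interval.length (X j)

record BalancedRepresentation (t : ℕ) {n : ℕ} (G : Graph n) : Set where
  field
    family     : Fin n → TrackInterval t
    balanced   : ∀ v → Balanced (family v)
    represents : ∀ u v → u ≢ v → Adjacent G u v ⇔ Intersect (family u) (family v)

encodeInterval : Interval → Val
encodeInterval I = pair (int lo) (int hi)
  where open Interval I

encodeRepresentation : ∀ {t n} {G : Graph n} → BalancedRepresentation t G → Val
encodeRepresentation R =
  encodeFamily λ v → encodeFamily λ i → encodeInterval (family v i)
  where open BalancedRepresentation R

-- φ H is the graph being represented: H itself or its complement.
record CutInstance (t : ℕ) (φ : ∀ {n} → Graph n → Graph n) : Set where
  field
    {n}            : ℕ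
    H              : Graph n
    representation : BalancedRepresentation t (φ H)
    k l            : ℕ

CuttingVia : ℕ → (∀ {n} → Graph n → Graph n) → ParameterizedProblem
CuttingVia t φ = record
  { Instance = CutInstance t φ
  ; encode   = λ x → pair (encodeGraph (H x))
                    (pair (encodeRepresentation (representation x))
                    (pair (encodeℕ (k x)) (encodeℕ (l x))))
  ; arity    = 2
  ; param    = λ x → k x ∷ l x ∷ []
  ; Yes      = λ x → CanCut (H x) (k x) (l x)
  }
  where open CutInstance

CuttingOnBalanced CuttingOnCoBalanced : ℕ → ParameterizedProblem
CuttingOnBalanced   t = CuttingVia t (λ G → G)
CuttingOnCoBalanced t = CuttingVia t complement

{-# OPTIONS --safe #-}
module Submission where

open import Defs
open import Data.Bool.Base using (Bool; true; false; T; _∧_; _∨_; not; if_then_else_)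
open import Data.Bool.Properties using (T?; T-∧; T-∨; ∧-comm; not-involutive)
open import Data.Empty using (⊥)
open import Data.Fin using (Fin; zero; suc; toℕ; fromℕ; fromℕ<; inject₁; inject≤; combine; remQuot; #_)
open import Data.Fin.Properties as Fin
  using (toℕ-injective; toℕ-fromℕ<; toℕ-inject≤; toℕ-inject₁; toℕ<n;
         any?; injective⇒≤; combine-injective; combine-remQuot)
open import Data.Fin.Subset using (Subset; inside; outside; _∈_; _∉_; ∣_∣; ⁅_⁆)
open import Data.Fin.Subset.Properties using (_∈?_; ⊆-antisym; x∈⁅x⁆; x∈⁅y⁆⇒x≡y)
open import Data.Integer.Base as ℤ using (ℤ)
import Data.Integer.Properties as ℤ
open import Data.List.Base as List using (List; []; _∷_; _ʳ++_; concatMap; downFrom; allFin; length)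
open import Data.List.Membership.Propositional using () renaming (_∈_ to _∈ᴸ_)
open import Data.List.Membership.Propositional.Properties
  using (∈-concatMap⁺; ∈-concatMap⁻; ∈-downFrom⁺; ∈-downFrom⁻; ∈-lookup; ∈-allFin; ∈-map⁺; ∈-map⁻)
import Data.List.Properties as List
open import Data.List.Relation.Unary.All as All using (All; []; _∷_)
import Data.List.Relation.Unary.All.Properties as All
open import Data.List.Relation.Unary.AllPairs as AllPairs using ([]; _∷_)
import Data.List.Relation.Unary.AllPairs.Properties as AllPairs
open import Data.List.Relation.Unary.Any as Any using (here; there)
open import Data.List.Relation.Unary.Any.Properties using (lookup-index)
open import Data.List.Relation.Unary.Unique.Propositional using (Unique)
import Data.List.Relation.Unary.Unique.Propositional.Properties as Unique
open import Data.Nat.Base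
open import Data.Nat.Logarithm
open import Data.Nat.Properties
open import Data.Nat.Tactic.RingSolver using (solve-∀)
open import Data.Product.Base using (∃; ∃₂; _×_; _,_; proj₁; proj₂)
open import Data.Product.Function.NonDependent.Propositional using (_×-⇔_)
open import Data.Sum.Base using (_⊎_; inj₁; inj₂)
open import Data.Unit.Base using (⊤; tt)
open import Data.Vec.Base as Vec using (Vec; []; _∷_; lookup; tabulate; here; there; _[_]≔_)
open import Data.Vec.Properties
  using (lookup⇒[]=; []=⇒lookup; lookup∘tabulate; lookup∘update; lookup∘update′; lookup-replicate)
open import Data.Vec.Relation.Binary.Pointwise.Inductive as Pointwise using ([]; _∷_)
open import Function.Base using (_∘_; id)
open import Function.Bundles using (_⇔_; mk⇔; Equivalence)
open import Function.Definitions using (Injective)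
import Function.Properties.Equivalence as ⇔
open import Relation.Binary.Construct.Closure.ReflexiveTransitive as Star using (Star; ε; _◅_; _◅◅_)
open import Relation.Binary.Definitions using (tri<; tri≈; tri>)
open import Relation.Binary.PropositionalEquality
open import Relation.Nullary.Decidable using (Dec; yes; no; decidable-stable; does; map)
open import Relation.Nullary.Negation using (¬_; contradiction)
open import Relation.Unary using (Decidable)

open Equivalence using (to; from)

-- The cut graph has the vertices of G and, for every ordered pair (u , v) with
-- u = v or u adjacent to v, M = k + 2 pairwise nonadjacent copies of the pair,
-- each seeing only u and v; consecutive vertices of G are adjacent.  Deleting
-- a clique of size k isolates k * k * M copies.  Conversely, if D has at most
-- k vertices, a component of the rest without a vertex of G is a copy of a
-- pair in D, and at most k + 1 < M components contain a vertex of G, since the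
-- least one is either 0 or follows a deleted vertex.  So k * k * M components
-- force all k * k pairs in D to be linked.
-- For two tracks, every vertex u owns a block on each track, and the copies of
-- (u , v) are short intervals in the block of u on the first track and in the
-- block of v on the second.  For the complement and three tracks, a copy of
-- (u , v) covers the vertices before both ends, between them and after both.

-- Cliques and cuts

-- The count of components is a pigeonhole argument on `Fin (k * (k * M))`: a component becomes two
-- positions among the at most k deleted vertices of G, and a copy number. Ordered pairs with the
-- diagonal make the target exactly this product, and the diagonal also forces k vertices of G to be
-- deleted. The obstacle is components containing vertices of G, which could stand in for missing
-- copies; chaining consecutive vertices caps them at k + 1, one less than M, so a single unlinked
-- pair already leaves a slot empty. The other edges among vertices of G are left open, which lets
-- one argument serve both layouts: there these vertices induce a path and a complete graph,
-- respectively. For the running time the obstacle is that k is written in binary, so M need not be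
-- polynomial in the input size. Every bound is therefore a power of X = (2 + k) * input size, and
-- the power of 2 + k becomes the factor depending on the parameter. All numbers that occur are
-- polynomial in X, so they may be measured in unary.

element : ∀ {n} (S : Subset n) → Fin ∣ S ∣ → Fin n
element (inside  ∷ S) zero    = zero
element (inside  ∷ S) (suc i) = suc (element S i)
element (outside ∷ S) i       = suc (element S i)

element-∈ : ∀ {n} (S : Subset n) i → element S i ∈ S
element-∈ (inside  ∷ S) zero    = here
element-∈ (inside  ∷ S) (suc i) = there (element-∈ S i)
element-∈ (outside ∷ S) i       = there (element-∈ S i)

element-injective : ∀ {n} (S : Subset n) → Injective _≡_ _≡_ (element S)
element-injective (inside  ∷ S) {zero}  {zero}  eq = refl
element-injective (inside  ∷ S) {suc i} {suc j} eq = cong suc (element-injective S (Fin.suc-injective eq))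
element-injective (outside ∷ S) eq = element-injective S (Fin.suc-injective eq)

rank : ∀ {n} (S : Subset n) {x} → x ∈ S → Fin ∣ S ∣
rank (inside  ∷ S) here      = zero
rank (inside  ∷ S) (there p) = suc (rank S p)
rank (outside ∷ S) (there p) = rank S p

element-rank : ∀ {n} (S : Subset n) {x} (p : x ∈ S) → element S (rank S p) ≡ x
element-rank (inside  ∷ S) here      = refl
element-rank (inside  ∷ S) (there p) = cong suc (element-rank S p)
element-rank (outside ∷ S) (there p) = cong suc (element-rank S p)

rank-injective : ∀ {n} (S : Subset n) {x y} (p : x ∈ S) (q : y ∈ S) →
                 rank S p ≡ rank S q → x ≡ y
rank-injective S p q eq =
  trans (sym (element-rank S p)) (trans (cong (element S) eq) (element-rank S q))

card-≤ : ∀ {m n} (S : Subset m) (R : Subset n) (f : Fin m → Fin n) →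
         (∀ {x y} → f x ≡ f y → x ≡ y) → (∀ {x} → x ∈ S → f x ∈ R) → ∣ S ∣ ≤ ∣ R ∣
card-≤ S R f f-inj S→R = injective⇒≤ {f = λ i → rank R (S→R (element-∈ S i))}
  (λ {i} {j} eq → element-injective S (f-inj (rank-injective R _ _ eq)))

∈-tabulate : ∀ {n} {f : Fin n → Bool} {x} → x ∈ tabulate f ⇔ T (f x)
∈-tabulate {f = f} {x} = mk⇔
  (λ p → subst T (trans (sym ([]=⇒lookup p)) (lookup∘tabulate f x)) tt)
  (λ t → lookup⇒[]= x (tabulate f) (trans (lookup∘tabulate f x) (T⇒true (f x) t)))
  where
  T⇒true : ∀ b → T b → b ≡ true
  T⇒true true _ = refl

least : ∀ {n} {P : Fin n → Set} → Decidable P → ∃ P →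
        ∃ λ u → P u × ∀ w → toℕ w < toℕ u → ¬ P w
least {suc n} {P} P? (u , Pu) with P? zero
... | yes P0 = zero , P0 , λ _ ()
least {suc n} {P} P? (zero  , Pu) | no ¬P0 = contradiction Pu ¬P0
least {suc n} {P} P? (suc u , Pu) | no ¬P0 with least (P? ∘ suc) (u , Pu)
... | v , Pv , min = suc v , Pv , λ where
  zero    _         → ¬P0
  (suc w) (s≤s w<v) → min w w<v

-- Pigeonhole: with a missed value `z` prepended, `f` would inject `suc n` elements into `n`.
injection-surjective : ∀ {n} {f : Fin n → Fin n} → Injective _≡_ _≡_ f → ∀ z → ¬ (∀ i → f i ≢ z)
injection-surjective {n} {f} f-inj z missed = 1+n≰n (injective⇒≤ g-inj)
  where
  g : Fin (suc n) → Fin n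
  g zero    = z
  g (suc i) = f i

  g-inj : Injective _≡_ _≡_ g
  g-inj {zero}  {zero}  eq = refl
  g-inj {zero}  {suc j} eq = contradiction (sym eq) (missed j)
  g-inj {suc i} {zero}  eq = contradiction eq (missed i)
  g-inj {suc i} {suc j} eq = cong suc (f-inj eq)

-- Two comparisons, because `leq` is the machine's only comparison; `equalE` evaluates to exactly
-- this Boolean.
equalᵇ : ℕ → ℕ → Bool
equalᵇ a b = (a ≤ᵇ b) ∧ (b ≤ᵇ a)

equalᵇ⇒≡ : ∀ a b → T (equalᵇ a b) → a ≡ b
equalᵇ⇒≡ a b t with Equivalence.to (T-∧ {a ≤ᵇ b}) t
... | p , q = ≤-antisym (≤ᵇ⇒≤ a b p) (≤ᵇ⇒≤ b a q)

equalᵇ-refl : ∀ a → T (equalᵇ a a)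
equalᵇ-refl a = Equivalence.from (T-∧ {a ≤ᵇ a}) (≤⇒≤ᵇ {a} ≤-refl , ≤⇒≤ᵇ {a} ≤-refl)

-- The cut graph, independent of its layout

-- pr u v c is the c-th copy of the ordered pair (u , v).
data Label (n : ℕ) : Set where
  vert : Fin n → Label n
  pr   : Fin n → Fin n → ℕ → Label n

linked : ∀ {n} → Graph n → Fin n → Fin n → Bool
linked G u v = Graph.adj G u v ∨ equalᵇ (toℕ u) (toℕ v)

Valid : ∀ {n} → Graph n → ℕ → Label n → Set
Valid G M (vert _)   = ⊤
Valid G M (pr u v c) = T (linked G u v) × c < M

linked-refl : ∀ {n} (G : Graph n) u → T (linked G u u)
linked-refl G u = from (T-∨ {Graph.adj G u u}) (inj₂ (equalᵇ-refl (toℕ u)))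

Adjacent⇒linked : ∀ {n} (G : Graph n) {u v} → Adjacent G u v → T (linked G u v)
Adjacent⇒linked G {u} {v} a = from (T-∨ {Graph.adj G u v}) (inj₁ a)

linked⇒Adjacent : ∀ {n} (G : Graph n) {u v} → T (linked G u v) → u ≢ v → Adjacent G u v
linked⇒Adjacent G {u} {v} l u≢v with to (T-∨ {Graph.adj G u v}) l
... | inj₁ a = a
... | inj₂ e = contradiction (toℕ-injective (equalᵇ⇒≡ _ _ e)) u≢v

module _ {N} (H : Graph N) (D : Subset N) where

  Reach : Fin N → Fin N → Set
  Reach = Star (EdgeAvoiding H D)

  Adjacent-sym : ∀ {x y} → Adjacent H x y → Adjacent H y x
  Adjacent-sym {x} {y} = subst T (Graph.symmetric H x y)

  Reach-sym : ∀ {x y} → Reach x y → Reach y x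
  Reach-sym = Star.reverse λ (x∉D , y∉D , xy) → y∉D , x∉D , Adjacent-sym xy

  Reach-∉ : ∀ {x y} → x ∉ D → Reach x y → y ∉ D
  Reach-∉ x∉D ε                     = x∉D
  Reach-∉ x∉D ((_ , y∉D , _) ◅ path) = Reach-∉ y∉D path

  components-disjoint : ∀ {A B z} → IsComponent H D A → IsComponent H D B →
                        z ∈ A → z ∈ B → A ≡ B
  components-disjoint (a , _ , A⇔) (b , _ , B⇔) z∈A z∈B = ⊆-antisym
    (λ w∈A → from (B⇔ _) (to (B⇔ _) z∈B ◅◅ Reach-sym (to (A⇔ _) z∈A) ◅◅ to (A⇔ _) w∈A))
    (λ w∈B → from (A⇔ _) (to (A⇔ _) z∈A ◅◅ Reach-sym (to (B⇔ _) z∈B) ◅◅ to (B⇔ _) w∈B))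

-- The interface between the clique argument and the two layouts. Nothing is fixed about
-- non-consecutive vertices of `G`: they are nonadjacent in the two-track graph and adjacent in the
-- complement of the three-track graph.
record IsCutGraph {n} (G : Graph n) (M : ℕ) {N} (H : Graph N) (label : Fin N → Label n) : Set where
  field
    label-injective : ∀ {x y} → label x ≡ label y → x ≡ y
    label-valid     : ∀ x → Valid G M (label x)
    locate          : ∀ ℓ → Valid G M ℓ → ∃ λ x → label x ≡ ℓ
    independent     : ∀ {x y u v c u′ v′ c′} → label x ≡ pr u v c → label y ≡ pr u′ v′ c′ →
                      ¬ Adjacent H x y
    incident        : ∀ {x y u v c w} → label x ≡ pr u v c → label y ≡ vert w →
                      Adjacent H x y ⇔ (w ≡ u ⊎ w ≡ v)
    consecutive     : ∀ {x y u w} → label x ≡ vert u → label y ≡ vert w →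
                      toℕ w ≡ suc (toℕ u) → Adjacent H x y

module CliqueVersusCut {n} (G : Graph n) (k : ℕ) {N} (H : Graph N) (label : Fin N → Label n)
                       (isCutGraph : IsCutGraph G (2 + k) H label) where

  open IsCutGraph isCutGraph

  private
    M = 2 + k
    l = k * (k * M)

  vertex : Fin n → Fin N
  vertex u = proj₁ (locate (vert u) tt)

  label-vertex : ∀ u → label (vertex u) ≡ vert u
  label-vertex u = proj₂ (locate (vert u) tt)

  vertex-injective : ∀ {u w} → vertex u ≡ vertex w → u ≡ w
  vertex-injective {u} {w} eq
    with refl ← trans (sym (label-vertex u)) (trans (cong label eq) (label-vertex w)) = refl

  is-vertex : ∀ {x u} → label x ≡ vert u → x ≡ vertex u
  is-vertex {u = u} eq = label-injective (trans eq (sym (label-vertex u)))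

  module CliqueToCut {S : Subset n} (∣S∣≡k : ∣ S ∣ ≡ k) (clique : IsClique G S) where

    ∈ᵇ-label : Label n → Bool
    ∈ᵇ-label (vert u)   = does (u ∈? S)
    ∈ᵇ-label (pr _ _ _) = false

    deleted : Subset N
    deleted = tabulate (∈ᵇ-label ∘ label)

    does⇒∈ : ∀ {u} → T (does (u ∈? S)) → u ∈ S
    does⇒∈ {u} t with yes p ← u ∈? S = p

    ∈⇒does : ∀ {u} → u ∈ S → T (does (u ∈? S))
    ∈⇒does {u} p with u ∈? S
    ... | yes _ = tt
    ... | no ¬p = ¬p p

    deleted-vert : ∀ {x} → x ∈ deleted → ∃ λ u → label x ≡ vert u × u ∈ S
    deleted-vert {x} p with label x | to ∈-tabulate p
    ... | vert u | t = u , refl , does⇒∈ t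

    pr-kept : ∀ {x u v c} → label x ≡ pr u v c → x ∉ deleted
    pr-kept eq p with _ , eq′ , _ ← deleted-vert p with () ← trans (sym eq) eq′

    vert-deleted : ∀ {x u} → label x ≡ vert u → u ∈ S → x ∈ deleted
    vert-deleted eq p = from ∈-tabulate (subst (T ∘ ∈ᵇ-label) (sym eq) (∈⇒does p))

    ∣deleted∣≤k : ∣ deleted ∣ ≤ k
    ∣deleted∣≤k = subst (∣ deleted ∣ ≤_) ∣S∣≡k (injective⇒≤ {f = f} f-inj)
      where
      split : ∀ i → ∃ λ u → label (element deleted i) ≡ vert u × u ∈ S
      split i = deleted-vert (element-∈ deleted i)

      f : Fin ∣ deleted ∣ → Fin ∣ S ∣
      f i = rank S (proj₂ (proj₂ (split i)))

      f-inj : Injective _≡_ _≡_ f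
      f-inj {i} {j} eq with split i | split j
      ... | u , lu , p | v , lv , q with refl ← rank-injective S p q eq =
        element-injective deleted (label-injective (trans lu (sym lv)))

    member : Fin k → Fin n
    member i = element S (subst Fin (sym ∣S∣≡k) i)

    member-∈ : ∀ i → member i ∈ S
    member-∈ i = element-∈ S _

    member-injective : ∀ {i j} → member i ≡ member j → i ≡ j
    member-injective eq = subst-injective (sym ∣S∣≡k) (element-injective S eq)

    members-linked : ∀ i j → T (linked G (member i) (member j))
    members-linked i j with member i Fin.≟ member j
    ... | yes eq = subst (λ v → T (linked G (member i) v)) eq (linked-refl G (member i))
    ... | no neq = Adjacent⇒linked G (clique _ _ (member-∈ i) (member-∈ j) neq)

    pairLabel : Fin k → Fin k → Fin M → Label n
    pairLabel i j c = pr (member i) (member j) (toℕ c)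

    pairAt : ∀ i j c → ∃ λ x → label x ≡ pairLabel i j c
    pairAt i j c = locate (pairLabel i j c) (members-linked i j , toℕ<n c)

    -- Any first step of a path would lead to an end of the pair, and both ends are deleted.
    pair-isolated : ∀ {i j c x y} → label x ≡ pairLabel i j c → Reach H deleted x y → y ≡ x
    pair-isolated eq ε = refl
    pair-isolated {i} {j} {c} {x} eq (_◅_ {j = y} (x∉ , y∉ , xy) _) with label y in eq′
    ... | pr _ _ _ = contradiction xy (independent eq eq′)
    ... | vert w with to (incident eq eq′) xy
    ... | inj₁ refl = contradiction (vert-deleted eq′ (member-∈ i)) y∉
    ... | inj₂ refl = contradiction (vert-deleted eq′ (member-∈ j)) y∉

    pairVertex : Fin l → Fin N
    pairVertex z = let i , jc = remQuot (k * M) z ; j , c = remQuot M jc in proj₁ (pairAt i j c)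

    pairVertex-injective : Injective _≡_ _≡_ pairVertex
    pairVertex-injective {z} {z′} eq = begin
      z                              ≡⟨ combine-remQuot {k} (k * M) z ⟨
      combine i jc                   ≡⟨ cong (combine i) (combine-remQuot {k} M jc) ⟨
      combine i (combine j c)        ≡⟨ same (trans (sym (proj₂ (pairAt i j c)))
                                          (trans (cong label eq) (proj₂ (pairAt i′ j′ c′)))) ⟩
      combine i′ (combine j′ c′)     ≡⟨ cong (combine i′) (combine-remQuot {k} M jc′) ⟩
      combine i′ jc′                 ≡⟨ combine-remQuot {k} (k * M) z′ ⟩
      z′                             ∎
      where
      open ≡-Reasoning
      i   = proj₁ (remQuot {k} (k * M) z)
      jc  = proj₂ (remQuot {k} (k * M) z)
      j   = proj₁ (remQuot {k} M jc)
      c   = proj₂ (remQuot {k} M jc)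
      i′  = proj₁ (remQuot {k} (k * M) z′)
      jc′ = proj₂ (remQuot {k} (k * M) z′)
      j′  = proj₁ (remQuot {k} M jc′)
      c′  = proj₂ (remQuot {k} M jc′)

      pr-injective : ∀ {u v c u′ v′ c′} → pr {n} u v c ≡ pr u′ v′ c′ → u ≡ u′ × v ≡ v′ × c ≡ c′
      pr-injective refl = refl , refl , refl

      same : ∀ {i j c i′ j′ c′} → pairLabel i j c ≡ pairLabel i′ j′ c′ →
             combine i (combine j c) ≡ combine i′ (combine j′ c′)
      same eq with pr-injective eq
      ... | p , q , r = cong₂ combine (member-injective p)
                          (cong₂ combine (member-injective q) (toℕ-injective r))

    clique⇒cut : CanCut H k l
    clique⇒cut = deleted , ∣deleted∣≤k , (λ z → ⁅ pairVertex z ⁆) ,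
      (λ {z} {z′} eq → pairVertex-injective
         (x∈⁅y⁆⇒x≡y _ (subst (pairVertex z ∈_) eq (x∈⁅x⁆ _)))) ,
      λ z → let i , jc = remQuot {k} (k * M) z ; j , c = remQuot {k} M jc in
        pairVertex z , pr-kept (proj₂ (pairAt i j c)) , λ w → mk⇔
          (λ w∈ → subst (Reach H deleted (pairVertex z)) (sym (x∈⁅y⁆⇒x≡y _ w∈)) ε)
          (λ path → subst (_∈ ⁅ pairVertex z ⁆) (sym (pair-isolated (proj₂ (pairAt i j c)) path)) (x∈⁅x⁆ _))

  module CutToClique {D : Subset N} (∣D∣≤k : ∣ D ∣ ≤ k) (C : Fin l → Subset N)
                     (C-inj : Injective _≡_ _≡_ C) (C-comp : ∀ i → IsComponent H D (C i)) where

    S : Subset n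
    S = tabulate λ u → lookup D (vertex u)

    ∈S⇒∈D : ∀ {u} → u ∈ S → vertex u ∈ D
    ∈S⇒∈D {u} p = lookup⇒[]= _ D (trans (sym (lookup∘tabulate _ u)) ([]=⇒lookup p))

    ∈D⇒∈S : ∀ {u} → vertex u ∈ D → u ∈ S
    ∈D⇒∈S {u} p = lookup⇒[]= u S (trans (lookup∘tabulate _ u) ([]=⇒lookup p))

    ∣S∣≤k : ∣ S ∣ ≤ k
    ∣S∣≤k = ≤-trans (card-≤ S D vertex vertex-injective ∈S⇒∈D) ∣D∣≤k

    index : ∀ {u} → u ∈ S → Fin k
    index p = inject≤ (rank S p) ∣S∣≤k

    index-injective : ∀ {u v} (p : u ∈ S) (q : v ∈ S) → index p ≡ index q → u ≡ v
    index-injective p q eq = rank-injective S p q (Fin.inject≤-injective _ _ _ _ eq)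

    -- Positions range over `Fin k` although `S` might be smaller, so being linked at every position
    -- says both that `S` has `k` elements and that it is a clique.
    LinkedAt : Fin k → Fin k → Set
    LinkedAt i j = ∃₂ λ u v → ∃₂ λ (p : u ∈ S) (q : v ∈ S) →
                   i ≡ index p × j ≡ index q × T (linked G u v)

    -- Codes a component by its least vertex u of G: either u = 0, or the
    -- vertex before u was deleted.
    data Border (u : Fin n) : Fin M → Set where
      first  : toℕ u ≡ 0 → Border u zero
      behind : ∀ {w} (p : w ∈ S) → toℕ u ≡ suc (toℕ w) → Border u (suc (inject₁ (index p)))

    border-unique : ∀ {u u′ c} → Border u c → Border u′ c → u ≡ u′
    border-unique b b′ = toℕ-injective (go b b′ refl)
      where
      go : ∀ {u u′ c c′} → Border u c → Border u′ c′ → c ≡ c′ → toℕ u ≡ toℕ u′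
      go (first p)    (first p′)     _  = trans p (sym p′)
      go (behind p e) (behind p′ e′) eq = trans e (trans
        (cong (suc ∘ toℕ) (index-injective p p′ (Fin.inject₁-injective (Fin.suc-injective eq)))) (sym e′))

    -- The codes in use are 0 and 1 plus a position below `k`, so `suc k` remains free.
    border-not-last : ∀ {u c} → Border u c → toℕ c ≢ suc k
    border-not-last (first _)    ()
    border-not-last (behind p _) eq = <⇒≢ (toℕ<n (index p)) (trans (sym (toℕ-inject₁ (index p))) (suc-injective eq))

    component-step : ∀ i {x y} → x ∈ C i → Adjacent H x y → y ∉ D → y ∈ C i
    component-step i x∈ xy y∉D with C-comp i
    ... | r , r∉D , C⇔ = from (C⇔ _)
      (to (C⇔ _) x∈ ◅◅ (Reach-∉ H D r∉D (to (C⇔ _) x∈) , y∉D , xy) ◅ ε)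

    border : ∀ i u → vertex u ∈ C i → (∀ w → toℕ w < toℕ u → vertex w ∉ C i) → ∃ (Border u)
    border i zero    _  _   = zero , first refl
    border i (suc u) u∈ min with inject₁ u ∈? S
    ... | yes p = _ , behind p (cong suc (sym (toℕ-inject₁ u)))
    -- A kept predecessor would be adjacent to `suc u`, hence in the same component, against
    -- minimality.
    ... | no ¬p = contradiction
      (component-step i u∈
        (Adjacent-sym H D (consecutive (label-vertex _) (label-vertex _) (cong suc (sym (toℕ-inject₁ u)))))
        (¬p ∘ ∈D⇒∈S))
      (min (inject₁ u) (s≤s (≤-reflexive (toℕ-inject₁ u))))

    -- If the pair of positions (i , j) is not linked, its k + 2 slots are
    -- free to absorb the at most k + 1 components with a vertex of G, which
    -- leaves one of the l slots unused by l components.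
    module _ {i j} (unlinked : ¬ LinkedAt i j) where

      data Slot : Subset N → Fin k → Fin k → Fin M → Set where
        mixed : ∀ {A u c} → vertex u ∈ A → Border u c → Slot A i j c
        alone : ∀ {A x u v c} (c<M : c < M) → x ∈ A → label x ≡ pr u v c → T (linked G u v) →
                (p : u ∈ S) (q : v ∈ S) → Slot A (index p) (index q) (fromℕ< c<M)

      slot : ∀ z → ∃ λ a → ∃₂ λ b c → Slot (C z) a b c
      slot z with any? (λ u → vertex u ∈? C z)
      ... | yes meets with least (λ u → vertex u ∈? C z) meets
      ... | u , u∈ , min with border z u u∈ min
      ... | c , b = i , j , c , mixed u∈ b
      slot z | no misses with C-comp z in eq
      ... | r , r∉D , C⇔ with label r in eq′ | label-valid r
      ... | vert u   | _ = contradiction (u , subst (_∈ C z) (is-vertex eq′) (from (C⇔ _) ε)) misses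
      ... | pr u v c | uv , c<M = _ , _ , _ ,
        alone c<M r∈ eq′ uv (inS (inj₁ refl)) (inS (inj₂ refl))
        where
        r∈ : r ∈ C z
        r∈ = from (C⇔ _) ε

        inS : ∀ {w} → w ≡ u ⊎ w ≡ v → w ∈ S
        inS {w} near with w ∈? S
        ... | yes p = p
        -- A kept end of the pair would be a vertex of `G` in the component.
        ... | no ¬p = contradiction
          (w , component-step z r∈ (from (incident eq′ (label-vertex w)) near) (¬p ∘ ∈D⇒∈S)) misses

      -- The two kinds cannot collide: a `mixed` slot lies at (i , j), an `alone` slot at a linked
      -- pair of positions. Within one kind, equal slots give a common vertex, and components
      -- sharing a vertex are equal.
      slot-injective : ∀ {A B a b c a′ b′ c′} → Slot A a b c → Slot B a′ b′ c′ →
                       IsComponent H D A → IsComponent H D B →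
                       a ≡ a′ → b ≡ b′ → c ≡ c′ → A ≡ B
      slot-injective (mixed u∈ b) (mixed u∈′ b′) cA cB _ _ refl with refl ← border-unique b b′ =
        components-disjoint H D cA cB u∈ u∈′
      slot-injective (mixed _ _) (alone _ _ _ uv p q) _ _ ea eb _ =
        contradiction (_ , _ , p , q , ea , eb , uv) unlinked
      slot-injective (alone _ _ _ uv p q) (mixed _ _) _ _ ea eb _ =
        contradiction (_ , _ , p , q , sym ea , sym eb , uv) unlinked
      slot-injective (alone c<M x∈ lx _ p q) (alone c′<M y∈ ly _ p′ q′) cA cB ea eb ec
        with refl ← index-injective p p′ ea | refl ← index-injective q q′ eb
           | refl ← trans (sym (toℕ-fromℕ< c<M)) (trans (cong toℕ ec) (toℕ-fromℕ< c′<M))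
        with refl ← label-injective (trans lx (sym ly)) = components-disjoint H D cA cB x∈ y∈

      slot-misses : ∀ {A a b c} → Slot A a b c → a ≡ i → b ≡ j → toℕ c ≢ suc k
      slot-misses (mixed _ b)          _  _  = border-not-last b
      slot-misses (alone _ _ _ uv p q) ea eb = contradiction (_ , _ , p , q , sym ea , sym eb , uv) unlinked

      absurd : ⊥
      -- The missed value is the last copy slot of (i , j).
      absurd = injection-surjective {f = f} f-inj (combine i (combine j (fromℕ (suc k)))) f-misses
        where
        f : Fin l → Fin l
        f z = let a , b , c , _ = slot z in combine a (combine b c)

        split : ∀ {a b} {c : Fin M} {a′ b′ c′} → combine {k} a (combine {k} b c) ≡ combine a′ (combine b′ c′) →
                a ≡ a′ × b ≡ b′ × c ≡ c′
        split {a} {b} {c} {a′} {b′} {c′} eq with combine-injective a _ a′ _ eq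
        ... | p , eq′ with combine-injective b c b′ c′ eq′
        ... | q , r = p , q , r

        f-inj : Injective _≡_ _≡_ f
        f-inj {z} {z′} eq with slot z | slot z′
        ... | a , b , c , x | a′ , b′ , c′ , y with split {a} {b} {c} eq
        ... | p , q , r = C-inj (slot-injective x y (C-comp z) (C-comp z′) p q r)

        f-misses : ∀ z → f z ≢ combine i (combine j (fromℕ (suc k)))
        f-misses z eq with slot z
        ... | a , b , c , x with split {a} {b} {c} eq
        ... | p , q , refl = slot-misses x p q (Fin.toℕ-fromℕ (suc k))

    linkedAt : ∀ i j → ¬ ¬ LinkedAt i j
    linkedAt i j unlinked = absurd unlinked

    k≤∣S∣ : k ≤ ∣ S ∣
    k≤∣S∣ = decidable-stable (k ≤? ∣ S ∣) λ k≰ →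
      -- Position `∣ S ∣` is the first one that no element of `S` occupies, so it cannot be linked
      -- even with itself.
      let i = fromℕ< (≰⇒> k≰) in linkedAt i i λ (u , _ , p , _ , eq , _) →
      <⇒≢ (toℕ<n (rank S p))
        (trans (sym (toℕ-inject≤ (rank S p) ∣S∣≤k)) (trans (cong toℕ (sym eq)) (toℕ-fromℕ< (≰⇒> k≰))))

    cut⇒clique : ∃ λ S → ∣ S ∣ ≡ k × IsClique G S
    cut⇒clique = S , ≤-antisym ∣S∣≤k k≤∣S∣ , λ u v p q u≢v →
      -- The pigeonhole gives only a double negation, which suffices since being linked is
      -- decidable.
      linked⇒Adjacent G (decidable-stable (T? _) λ ¬uv →
        linkedAt (index p) (index q) λ (u′ , v′ , p′ , q′ , eu , ev , uv) →
          ¬uv (subst₂ (λ u v → T (linked G u v))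
                 (sym (index-injective p p′ eu)) (sym (index-injective q q′ ev)) uv)) u≢v

  clique⇔cut : (∃ λ S → ∣ S ∣ ≡ k × IsClique G S) ⇔ CanCut H k l
  clique⇔cut = mk⇔
    (λ (S , ∣S∣≡k , clique) → CliqueToCut.clique⇒cut ∣S∣≡k clique)
    (λ (D , ∣D∣≤k , C , C-inj , C-comp) → CutToClique.cut⇒clique ∣D∣≤k C C-inj C-comp)

open ≤-Reasoning hiding (start; stop)

-- Cost of programs

-- The size with integers in unary. It dominates `size` and, unlike bit length, follows the
-- arithmetic operations directly.
mag : Val → ℕ
mag (int i)    = suc ℤ.∣ i ∣
mag (pair u v) = suc (mag u + mag v)

1+n≤2^n : ∀ n → suc n ≤ 2 ^ n
1+n≤2^n zero    = ≤-refl
1+n≤2^n (suc n) = begin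
  1 + suc n          ≤⟨ +-mono-≤ (≤-trans (s≤s z≤n) (1+n≤2^n n)) (1+n≤2^n n) ⟩
  2 ^ n + 2 ^ n      ≡⟨ cong (2 ^ n +_) (+-identityʳ (2 ^ n)) ⟨
  2 * 2 ^ n          ∎

size≤mag : ∀ v → size v ≤ mag v
size≤mag (int i)    = s≤s (begin
  ⌈log₂ suc ℤ.∣ i ∣ ⌉    ≤⟨ ⌈log₂⌉-mono-≤ (1+n≤2^n ℤ.∣ i ∣) ⟩
  ⌈log₂ 2 ^ ℤ.∣ i ∣ ⌉    ≡⟨ ⌈log₂2^n⌉≡n ℤ.∣ i ∣ ⟩
  ℤ.∣ i ∣                ∎)
size≤mag (pair u v) = s≤s (+-mono-≤ (size≤mag u) (size≤mag v))

mag-fst : ∀ v → mag (fst v) ≤ mag v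
mag-fst (int _)    = s≤s z≤n
mag-fst (pair u v) = m≤n⇒m≤1+n (m≤m+n (mag u) (mag v))

mag-snd : ∀ v → mag (snd v) ≤ mag v
mag-snd (int _)    = s≤s z≤n
mag-snd (pair u v) = m≤n⇒m≤1+n (m≤n+m (mag v) (mag u))

mag-toℤ : ∀ v → suc ℤ.∣ toℤ v ∣ ≤ mag v
mag-toℤ (int i)    = ≤-refl
mag-toℤ (pair _ _) = s≤s z≤n

mag-fromBool : ∀ b → mag (fromBool b) ≤ 2
mag-fromBool true  = ≤-refl
mag-fromBool false = s≤s z≤n

mag-add : ∀ i j → mag (int (i ℤ.+ j)) ≤ suc ℤ.∣ i ∣ + suc ℤ.∣ j ∣
mag-add i j = s≤s (≤-trans (ℤ.∣i+j∣≤∣i∣+∣j∣ i j) (+-monoʳ-≤ ℤ.∣ i ∣ (n≤1+n _)))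

mag-sub : ∀ i j → mag (int (i ℤ.- j)) ≤ suc ℤ.∣ i ∣ + suc ℤ.∣ j ∣
mag-sub i j = s≤s (≤-trans (ℤ.∣i-j∣≤∣i∣+∣j∣ i j) (+-monoʳ-≤ ℤ.∣ i ∣ (n≤1+n _)))

-- Thanks to the added 1 the magnitude is submultiplicative, so exponents add under products.
mag-mul : ∀ i j → mag (int (i ℤ.* j)) ≤ suc ℤ.∣ i ∣ * suc ℤ.∣ j ∣
mag-mul i j rewrite ℤ.abs-* i j = s≤s (begin
  ℤ.∣ i ∣ * ℤ.∣ j ∣                     ≤⟨ *-monoʳ-≤ ℤ.∣ i ∣ (n≤1+n _) ⟩
  ℤ.∣ i ∣ * suc ℤ.∣ j ∣                 ≤⟨ m≤n+m _ ℤ.∣ j ∣ ⟩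
  ℤ.∣ j ∣ + ℤ.∣ i ∣ * suc ℤ.∣ j ∣       ∎)

-- Every bound below is a power of a fixed X ≥ 2, so that a bound is a closed
-- numeral; ⊕ is the exponent of a sum.
infixr 5 _⊕_
_⊕_ : ℕ → ℕ → ℕ
a ⊕ b = suc (a ⊔ b)

module _ {m : ℕ} (ρ : Vec ℕ m) where

  magExponent : Expr m → ℕ
  magExponent (var x)    = lookup ρ x
  magExponent (lit i)    = suc ℤ.∣ i ∣
  magExponent (cons d e) = 0 ⊕ magExponent d ⊕ magExponent e
  magExponent (hd e)     = magExponent e
  magExponent (tl e)     = magExponent e
  magExponent (isPair e) = 1
  magExponent (add d e)  = magExponent d ⊕ magExponent e
  magExponent (sub d e)  = magExponent d ⊕ magExponent e
  magExponent (mul d e)  = magExponent d + magExponent e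
  magExponent (leq d e)  = 1

  costExponent : Expr m → ℕ
  costExponent e@(var _)    = magExponent e ⊕ 0
  costExponent e@(lit _)    = magExponent e ⊕ 0
  costExponent e@(cons d f) = magExponent e ⊕ costExponent d ⊕ costExponent f
  costExponent e@(hd d)     = magExponent e ⊕ costExponent d
  costExponent e@(tl d)     = magExponent e ⊕ costExponent d
  costExponent e@(isPair d) = magExponent e ⊕ costExponent d
  costExponent e@(add d f)  = magExponent e ⊕ costExponent d ⊕ costExponent f
  costExponent e@(sub d f)  = magExponent e ⊕ costExponent d ⊕ costExponent f
  costExponent e@(mul d f)  = magExponent e ⊕ costExponent d ⊕ costExponent f
  costExponent e@(leq d f)  = magExponent e ⊕ costExponent d ⊕ costExponent f

  -- q: no loop may run for more than X ^ q rounds.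
  timeExponent : ℕ → Code m → ℕ
  timeExponent q skip         = 0
  timeExponent q (x := e)     = 0 ⊕ costExponent e
  timeExponent q (c ⨾ d)      = timeExponent q c ⊕ timeExponent q d
  timeExponent q (cond e c d) = 0 ⊕ costExponent e ⊕ (timeExponent q c ⊔ timeExponent q d)
  timeExponent q (while e c)  = (0 ⊕ q) + (0 ⊕ costExponent e ⊕ timeExponent q c)

module Powers (X : ℕ) (2≤X : 2 ≤ X) where

  instance
    X≢0 : NonZero X
    X≢0 = >-nonZero (≤-trans (s≤s z≤n) 2≤X)

  infix 4 _⊑_
  record _⊑_ (x a : ℕ) : Set where
    constructor bounded
    field
      bound : x ≤ X ^ a
  open _⊑_ public

  ⊑-trans : ∀ {a x y} → x ≤ y → y ⊑ a → x ⊑ a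
  ⊑-trans x≤y (bounded p) = bounded (≤-trans x≤y p)

  ⊑-raise : ∀ {a b x} → a ≤ b → x ⊑ a → x ⊑ b
  ⊑-raise a≤b (bounded p) = bounded (≤-trans p (^-monoʳ-≤ X a≤b))

  1⊑0 : 1 ⊑ 0
  1⊑0 = bounded ≤-refl

  0⊑0 : 0 ⊑ 0
  0⊑0 = bounded z≤n

  2⊑1 : 2 ⊑ 1
  2⊑1 = bounded (≤-trans 2≤X (≤-reflexive (sym (*-identityʳ X))))

  -- After raising both summands to the larger exponent, the factor 2 is absorbed by one more power
  -- of X.
  ⊑-sum : ∀ {a b x y} → x ⊑ a → y ⊑ b → x + y ⊑ a ⊕ b
  ⊑-sum {a} {b} {x} {y} p q = bounded (begin
    x + y                          ≤⟨ +-mono-≤ (bound (⊑-raise (m≤m⊔n a b) p)) (bound (⊑-raise (m≤n⊔m a b) q)) ⟩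
    X ^ (a ⊔ b) + X ^ (a ⊔ b)      ≡⟨ cong (X ^ (a ⊔ b) +_) (+-identityʳ _) ⟨
    2 * X ^ (a ⊔ b)                ≤⟨ *-monoˡ-≤ (X ^ (a ⊔ b)) 2≤X ⟩
    X ^ (a ⊕ b)                    ∎)

  ⊑-suc : ∀ {a x} → x ⊑ a → suc x ⊑ 0 ⊕ a
  ⊑-suc = ⊑-sum 1⊑0

  ⊑-product : ∀ {a b x y} → x ⊑ a → y ⊑ b → x * y ⊑ a + b
  ⊑-product {a} {b} {x} {y} (bounded p) (bounded q) = bounded (begin
    x * y            ≤⟨ *-mono-≤ p q ⟩
    X ^ a * X ^ b    ≡⟨ ^-distribˡ-+-* X a b ⟨
    X ^ (a + b)      ∎)

  n⊑n : ∀ n → n ⊑ n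
  n⊑n n = bounded (≤-trans (n≤1+n n) (≤-trans (1+n≤2^n n) (^-monoˡ-≤ n 2≤X)))

  module Bounded {m : ℕ} (ρ : Vec ℕ m) (q : ℕ) where

    Fits : Store m → Set
    Fits s = ∀ x → mag (lookup s x) ⊑ lookup ρ x

    module _ {s : Store m} (fits : Fits s) where

      mag-eval : ∀ e → mag (eval e s) ⊑ magExponent ρ e
      mag-eval (var x)    = fits x
      mag-eval (lit i)    = n⊑n (suc ℤ.∣ i ∣)
      mag-eval (cons d e) = ⊑-suc (⊑-sum (mag-eval d) (mag-eval e))
      mag-eval (hd e)     = ⊑-trans (mag-fst (eval e s)) (mag-eval e)
      mag-eval (tl e)     = ⊑-trans (mag-snd (eval e s)) (mag-eval e)
      mag-eval (isPair e) = ⊑-trans (mag-fromBool (pair? (eval e s))) 2⊑1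
      mag-eval (add d e)  = ⊑-trans (mag-add (toℤ (eval d s)) (toℤ (eval e s))) (⊑-sum
        (⊑-trans (mag-toℤ (eval d s)) (mag-eval d)) (⊑-trans (mag-toℤ (eval e s)) (mag-eval e)))
      mag-eval (sub d e)  = ⊑-trans (mag-sub (toℤ (eval d s)) (toℤ (eval e s))) (⊑-sum
        (⊑-trans (mag-toℤ (eval d s)) (mag-eval d)) (⊑-trans (mag-toℤ (eval e s)) (mag-eval e)))
      mag-eval (mul d e)  = ⊑-trans (mag-mul (toℤ (eval d s)) (toℤ (eval e s)))
        (⊑-product
        (⊑-trans (mag-toℤ (eval d s)) (mag-eval d)) (⊑-trans (mag-toℤ (eval e s)) (mag-eval e)))
      mag-eval (leq d e)  = ⊑-trans (mag-fromBool (toℤ (eval d s) ℤ.≤ᵇ toℤ (eval e s)))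
        2⊑1

      size-eval : ∀ e → size (eval e s) ⊑ magExponent ρ e
      size-eval e = ⊑-trans (size≤mag (eval e s)) (mag-eval e)

      cost-bound : ∀ e → cost e s ⊑ costExponent ρ e
      cost-bound e@(var _)    = ⊑-sum (size-eval e) 0⊑0
      cost-bound e@(lit _)    = ⊑-sum (size-eval e) 0⊑0
      cost-bound e@(cons d f) = ⊑-sum (size-eval e) (⊑-sum (cost-bound d) (cost-bound f))
      cost-bound e@(hd d)     = ⊑-sum (size-eval e) (cost-bound d)
      cost-bound e@(tl d)     = ⊑-sum (size-eval e) (cost-bound d)
      cost-bound e@(isPair d) = ⊑-sum (size-eval e) (cost-bound d)
      cost-bound e@(add d f)  = ⊑-sum (size-eval e) (⊑-sum (cost-bound d) (cost-bound f))
      cost-bound e@(sub d f)  = ⊑-sum (size-eval e) (⊑-sum (cost-bound d) (cost-bound f))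
      cost-bound e@(mul d f)  = ⊑-sum (size-eval e) (⊑-sum (cost-bound d) (cost-bound f))
      cost-bound e@(leq d f)  = ⊑-sum (size-eval e) (⊑-sum (cost-bound d) (cost-bound f))

    -- `Fits` is assumed and returned, so in a sequence of runs each assignment has to bound only
    -- the value it writes.
    record Run (c : Code m) (s s′ : Store m) : Set where
      constructor run
      field
        proof : Fits s → Fits s′ × ∃ λ t → Exec c s s′ t × t ⊑ timeExponent ρ q c
    open Run public

    Run-skip : ∀ {s} → Run skip s s
    Run-skip .proof fits = fits , 1 , skip , 1⊑0

    Run-assign : ∀ {s} x e {v} → eval e s ≡ v → mag v ⊑ lookup ρ x →
                 Run (x := e) s (s [ x ]≔ v)
    Run-assign {s} x e refl bound .proof fits =
      fits′ , _ , assign x e , ⊑-suc (cost-bound fits e)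
      where
      fits′ : Fits (s [ x ]≔ eval e s)
      fits′ y with y Fin.≟ x
      ... | yes refl = subst (λ v → mag v ⊑ lookup ρ x) (sym (lookup∘update x s (eval e s))) bound
      ... | no  y≢x  = subst (λ v → mag v ⊑ lookup ρ y) (sym (lookup∘update′ y≢x s (eval e s))) (fits y)

    infixr 5 _⨾ᴿ_
    _⨾ᴿ_ : ∀ {c d s s′ s″} → Run c s s′ → Run d s′ s″ → Run (c ⨾ d) s s″
    (C ⨾ᴿ D) .proof fits with C .proof fits
    ... | fits′ , t , p , t≤ with D .proof fits′
    ... | fits″ , u , r , u≤ = fits″ , t + u , seq p r , ⊑-sum t≤ u≤

    Run-then : ∀ {e c d s s′} → truthy (eval e s) ≡ true → Run c s s′ → Run (cond e c d) s s′
    Run-then {e} {c} {d} guard C .proof fits with C .proof fits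
    ... | fits′ , t , p , t≤ = fits′ , _ , then guard p ,
      ⊑-suc (⊑-sum (cost-bound fits e) (⊑-raise (m≤m⊔n (timeExponent ρ q c) (timeExponent ρ q d)) t≤))

    Run-else : ∀ {e c d s s′} → truthy (eval e s) ≡ false → Run d s s′ → Run (cond e c d) s s′
    Run-else {e} {c} {d} guard D .proof fits with D .proof fits
    ... | fits′ , t , p , t≤ = fits′ , _ , else guard p ,
      ⊑-suc (⊑-sum (cost-bound fits e) (⊑-raise (m≤n⊔m (timeExponent ρ q c) (timeExponent ρ q d)) t≤))

    data Rounds (e : Expr m) (c : Code m) : ℕ → Store m → Store m → Set where
      done : ∀ {s} → truthy (eval e s) ≡ false → Rounds e c 0 s s
      more : ∀ {n s s′ s″} → truthy (eval e s) ≡ true → Run c s s′ →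
             Rounds e c n s′ s″ → Rounds e c (suc n) s s″

    -- Each of the `n` rounds and the final failing test takes at most `X ^ b`, whence the factor
    -- `suc n`.
    Run-while : ∀ {e c n s s′} → Rounds e c n s s′ → n ⊑ q → Run (while e c) s s′
    Run-while {e} {c} {n} {s₀} {s₁} rounds n⊑q .proof fits₀ with go rounds fits₀
      where
      b = 0 ⊕ costExponent ρ e ⊕ timeExponent ρ q c

      go : ∀ {n s s′} → Rounds e c n s s′ → Fits s →
           Fits s′ × ∃ λ t → Exec (while e c) s s′ t × t ≤ suc n * X ^ b
      go {s = s} (done guard) fits = fits , _ , stop guard , (begin
        suc (cost e s)    ≤⟨ bound (⊑-suc (⊑-raise (≤-trans (m≤m⊔n _ _) (n≤1+n _)) (cost-bound fits e))) ⟩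
        X ^ b             ≡⟨ *-identityˡ (X ^ b) ⟨
        1 * X ^ b         ∎)
      go {s = s} (more {n} guard C rest) fits with C .proof fits
      ... | fits′ , t , p , t⊑ with go rest fits′
      ... | fits″ , u , r , u≤ = fits″ , _ , loop guard p r , (begin
        suc (cost e s + (t + u))      ≡⟨ cong suc (+-assoc (cost e s) t u) ⟨
        suc (cost e s + t) + u        ≤⟨ +-mono-≤ (bound (⊑-suc (⊑-sum (cost-bound fits e) t⊑))) u≤ ⟩
        X ^ b + suc n * X ^ b         ∎)
    ... | fits₁ , t , p , t≤ = fits₁ , t , p ,
      ⊑-trans t≤ (⊑-product (⊑-suc n⊑q) (bounded ≤-refl))

-- Track layouts

-- Left endpoints on the t tracks and the common length.
Placement : ℕ → Set
Placement t = (Fin t → ℕ) × ℕ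

MeetsOn : ∀ {t} → Fin t → Placement t → Placement t → Set
MeetsOn i (s , l) (s′ , l′) = s i ≤ s′ i + l′ × s′ i ≤ s i + l

Meets : ∀ {t} → Placement t → Placement t → Set
Meets p p′ = ∃ λ i → MeetsOn i p p′

-- co: the intersection graph is the complement of the cut graph.
Joined : Bool → Set → Set
Joined co P = if co then ¬ P else P

-- The conditions of `IsCutGraph` in coordinates. A copy may meet itself, which is why `pr-pr`
-- concludes an equality of labels instead of an absurdity.
record Geometry : Set where
  field
    tracks : ℕ
    co     : Bool
    vertAt : (n M u : ℕ) → Placement tracks
    prAt   : (n M u v c : ℕ) → Placement tracks

    vertAt-positive : ∀ n {M} u → 0 < M → 0 < proj₂ (vertAt n M u)
    prAt-positive   : ∀ n M u v c → 0 < proj₂ (prAt n M u v c)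

    pr-pr     : ∀ {n M u v c u′ v′ c′} → u < n → v < n → c < M → u′ < n → v′ < n → c′ < M →
                Joined co (Meets (prAt n M u v c) (prAt n M u′ v′ c′)) → u ≡ u′ × v ≡ v′ × c ≡ c′
    pr-vert   : ∀ {n M u v c w} → u < n → v < n → c < M → w < n →
                Joined co (Meets (prAt n M u v c) (vertAt n M w)) ⇔ (w ≡ u ⊎ w ≡ v)
    vert-vert : ∀ {n M u} → 0 < M → suc u < n → Joined co (Meets (vertAt n M u) (vertAt n M (suc u)))

-- Mixed-radix keys

block : ℕ → ℕ → ℕ
block n M = suc n * M

-- A mixed-radix number with digits `u`, `suc v` and `c`. The middle digit starts at 1, so the
-- beginning of the block is reserved for the vertex `u` itself; this is why a block has `suc n`
-- sections of width `M`.
key : (n M u v c : ℕ) → ℕ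
key n M u v c = u * block n M + (suc v * M + c)

offset<block : ∀ {n M v c} → v < n → c < M → suc v * M + c < block n M
offset<block {n} {M} {v} {c} v<n c<M = begin-strict
  suc v * M + c        <⟨ +-monoʳ-< (suc v * M) c<M ⟩
  suc v * M + M        ≡⟨ +-comm (suc v * M) M ⟩
  suc (suc v) * M      ≤⟨ *-monoˡ-≤ M (s≤s v<n) ⟩
  block n M            ∎

0<offset : ∀ {M} v {c} → c < M → 0 < suc v * M + c
0<offset {suc M} v _ = z<s

block-mono : ∀ {a b B} → a < b → a * B + B ≤ b * B
block-mono {a} {b} {B} a<b = ≤-trans (≤-reflexive (+-comm (a * B) B)) (*-monoˡ-≤ B a<b)

quotient-≤ : ∀ {a b r B} → a * B ≤ b * B + r → r < B → a ≤ b
quotient-≤ {a} {b} {r} {B} p r<B = ≮⇒≥ λ b<a →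
  <⇒≱ (<-≤-trans (+-monoʳ-< (b * B) r<B) (block-mono b<a)) p

digits-unique : ∀ {a b r r′ B} → r < B → r′ < B → a * B + r ≡ b * B + r′ → a ≡ b × r ≡ r′
digits-unique {a} {b} {r} {r′} {B} r<B r′<B eq
  with refl ← ≤-antisym (quotient-≤ {a} {b} (≤-trans (m≤m+n (a * B) r) (≤-reflexive eq)) r′<B)
                        (quotient-≤ {b} {a} (≤-trans (m≤m+n (b * B) r′) (≤-reflexive (sym eq))) r<B)
  = refl , +-cancelˡ-≡ (a * B) r r′ eq

key-injective : ∀ {n M u v c u′ v′ c′} → v < n → c < M → v′ < n → c′ < M →
                key n M u v c ≡ key n M u′ v′ c′ → u ≡ u′ × v ≡ v′ × c ≡ c′
key-injective {n} {M} {u} {v} {u′ = u′} {v′} v< c< v′< c′< eq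
  with digits-unique {u} {u′} {B = block n M} (offset<block v< c<) (offset<block v′< c′<) eq
... | p , eq′ with digits-unique {suc v} {suc v′} {B = M} c< c′< eq′
... | q , r = p , suc-injective q , r

half-≤ : ∀ {x y} → 2 * x ≤ 2 * y + 1 → x ≤ y
half-≤ {x} {y} p = ≮⇒≥ λ y<x → <⇒≱ (begin-strict
  2 * y + 1      <⟨ +-monoʳ-< (2 * y) (s≤s (s≤s z≤n)) ⟩
  2 * y + 2      ≡⟨ solve₁ y ⟩
  2 * suc y      ≤⟨ *-monoʳ-≤ 2 y<x ⟩
  2 * x          ∎) p
  where
  solve₁ : ∀ y → 2 * y + 2 ≡ 2 * suc y
  solve₁ = solve-∀

module TwoTracks where

  -- The closed blocks share endpoints, so that consecutive vertices meet. Doubled coordinates give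
  -- the copies positive length: `[2x , 2x + 1]` and `[2y , 2y + 1]` are disjoint for x ≠ y.
  vertAt : (n M u : ℕ) → Placement 2
  vertAt n M u = (λ _ → 2 * (u * block n M)) , 2 * block n M

  prAt : (n M u v c : ℕ) → Placement 2
  prAt n M u v c = (λ { zero → 2 * key n M u v c ; (suc _) → 2 * key n M v u c }) , 1

  unit-meets : ∀ {x y} → 2 * x ≤ 2 * y + 1 → 2 * y ≤ 2 * x + 1 → x ≡ y
  unit-meets p q = ≤-antisym (half-≤ p) (half-≤ q)

  pr-pr : ∀ {n M u v c u′ v′ c′} → u < n → v < n → c < M → u′ < n → v′ < n → c′ < M →
          Meets (prAt n M u v c) (prAt n M u′ v′ c′) → u ≡ u′ × v ≡ v′ × c ≡ c′
  pr-pr u< v< c< u′< v′< c′< (zero , p , q) = key-injective v< c< v′< c′< (unit-meets p q)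
  pr-pr u< v< c< u′< v′< c′< (suc zero , p , q)
    with key-injective u< c< u′< c′< (unit-meets p q)
  ... | x , y , z = y , x , z

  track⇒ : ∀ {n M a b c w} → b < n → c < M →
           2 * key n M a b c ≤ 2 * (w * block n M) + 2 * block n M →
           2 * (w * block n M) ≤ 2 * key n M a b c + 1 → w ≡ a
  track⇒ {n} {M} {a} {b} {c} {w} b< c< p q = ≤-antisym
    (quotient-≤ (half-≤ q) (offset<block b< c<))
    (≮⇒≥ λ w<a → <⇒≱ (begin-strict
      w * B + B          ≤⟨ block-mono w<a ⟩
      -- The positive offset keeps the copy clear of the endpoint that its block shares with the
      -- previous one.
      a * B              <⟨ m<m+n (a * B) (0<offset b c<) ⟩
      key n M a b c      ∎)
      (*-cancelˡ-≤ 2 (≤-trans p (≤-reflexive (sym (*-distribˡ-+ 2 (w * B) B))))))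
    where B = block n M

  track⇐ : ∀ {n M} a {b c} → b < n → c < M →
           2 * key n M a b c ≤ 2 * (a * block n M) + 2 * block n M ×
           2 * (a * block n M) ≤ 2 * key n M a b c + 1
  track⇐ {n} {M} a {b} {c} b< c< =
    (begin
      2 * key n M a b c            ≤⟨ *-monoʳ-≤ 2 (+-monoʳ-≤ (a * B) (<⇒≤ (offset<block b< c<))) ⟩
      2 * (a * B + B)              ≡⟨ *-distribˡ-+ 2 (a * B) B ⟩
      2 * (a * B) + 2 * B          ∎) ,
    ≤-trans (*-monoʳ-≤ 2 (m≤m+n (a * B) _)) (m≤m+n _ 1)
    where B = block n M

  geometry : Geometry
  geometry = record
    { tracks = 2
    ; co     = false
    ; vertAt = vertAt
    ; prAt   = prAt
    ; vertAt-positive = λ { n {suc M} u _ → z<s }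
    ; prAt-positive   = λ _ _ _ _ _ → z<s
    ; pr-pr     = pr-pr
    ; pr-vert   = λ {n} {M} {u} {v} u< v< c< w< → mk⇔
        (λ { (zero , p , q)     → inj₁ (track⇒ {n} {M} {u} v< c< p q)
           ; (suc zero , p , q) → inj₂ (track⇒ {n} {M} {v} u< c< p q) })
        (λ { (inj₁ refl) → zero , track⇐ u v< c<
           ; (inj₂ refl) → suc zero , track⇐ v u< c< })
    ; vert-vert = λ {n} {M} {u} _ _ → let B = block n M in zero ,
        ≤-trans (*-monoʳ-≤ 2 (*-monoˡ-≤ B (n≤1+n u))) (m≤m+n _ _) ,
        ≤-reflexive (trans (cong (2 *_) (+-comm B (u * B))) (*-distribˡ-+ 2 (u * B) B))
    }

module ThreeTracks where

  -- Balance makes the three intervals of a copy equally long, although the middle one may have no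
  -- vertex to cover while the outer ones must reach past all vertices, for which `short n`
  -- suffices. So vertices on the middle track are `wide n` apart, leaving room for a length of
  -- `short n` between neighbours: 2 before it, to clear the vertex interval of length 1, and 1
  -- after it.
  short wide : ℕ → ℕ
  short n = suc (3 * n)
  wide n  = short n + 3

  -- Truncated to 0 when u = v: the middle interval then lies between two
  -- neighbouring vertices, as it does when v = u + 1.
  gap : ℕ → ℕ → ℕ
  gap u v = (u ⊔ v) ∸ suc (u ⊓ v)

  vertAt : (n M w : ℕ) → Placement 3
  vertAt n M w =
    (λ { zero → 3 * (n ∸ w) ; (suc zero) → wide n * w ; (suc (suc _)) → 3 * w }) , 1

  -- Every interval extends to the right of the vertices to be avoided. Track 0 lists the vertices
  -- in reverse, so the vertices before both ends lie to the right there as well; each start is 2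
  -- past that of an end, just beyond its interval.
  prAt : (n M u v c : ℕ) → Placement 3
  prAt n M u v c =
    (λ { zero → 3 * (n ∸ u ⊓ v) + 2 ; (suc zero) → wide n * (u ⊓ v) + 2 ; (suc (suc _)) → 3 * (u ⊔ v) + 2 }) ,
    wide n * gap u v + short n

  thrice-< : ∀ {x y} → 3 * x + 2 ≤ 3 * y + 1 → x < y
  thrice-< {x} {y} p = ≰⇒> λ y≤x → <⇒≱ (begin-strict
    3 * y + 1      <⟨ +-mono-≤-< (*-monoʳ-≤ 3 y≤x) (n<1+n 1) ⟩
    3 * x + 2      ∎) p

  <-thrice : ∀ {x y} → x < y → 3 * x + 2 ≤ 3 * y + 1
  <-thrice {x} {y} x<y = begin
    3 * x + 2      ≤⟨ +-monoʳ-≤ (3 * x) (n≤1+n 2) ⟩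
    3 * x + 3      ≡⟨ solve₁ x ⟩
    3 * suc x      ≤⟨ *-monoʳ-≤ 3 x<y ⟩
    3 * y          ≤⟨ m≤m+n (3 * y) 1 ⟩
    3 * y + 1      ∎
    where
    solve₁ : ∀ x → 3 * x + 3 ≡ 3 * suc x
    solve₁ = solve-∀

  -- Every pr is long enough to reach across all vertices on tracks 0 and 2.
  reach : ∀ {n w x} y → w ≤ n → 3 * w ≤ 3 * x + 2 + (wide n * y + short n)
  reach {n} {w} {x} y w≤n = begin
    3 * w                                      ≤⟨ *-monoʳ-≤ 3 w≤n ⟩
    3 * n                                      ≤⟨ n≤1+n _ ⟩
    short n                                    ≤⟨ m≤n+m _ (wide n * y) ⟩
    wide n * y + short n                       ≤⟨ m≤n+m _ (3 * x + 2) ⟩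
    3 * x + 2 + (wide n * y + short n)         ∎

  between⇒ : ∀ {a b w} → a < w → w ≤ a + (b ∸ suc a) → w < b
  between⇒ {a} {b} {w} a<w p with suc a ≤? b
  ... | yes a<b = ≤-trans (s≤s p) (≤-reflexive (m+[n∸m]≡n a<b))
  ... | no  a≮b = contradiction
    (≤-trans p (≤-reflexive (trans (cong (a +_) (m≤n⇒m∸n≡0 (≰⇒≥ a≮b))) (+-identityʳ a)))) (<⇒≱ a<w)

  between⇐ : ∀ {a b w} → a < w → w < b → w ≤ a + (b ∸ suc a)
  between⇐ a<w w<b = s≤s⁻¹ (≤-trans w<b (≤-reflexive (sym (m+[n∸m]≡n (≤-trans (s≤s (<⇒≤ a<w)) w<b)))))

  middle⇒ : ∀ {n a h w} → wide n * a + 2 ≤ wide n * w + 1 →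
            wide n * w ≤ wide n * a + 2 + (wide n * h + short n) → a < w × w ≤ a + h
  middle⇒ {n} {a} {h} {w} p q =
    ≰⇒> (λ w≤a → <⇒≱ (begin-strict
      W * w + 1      <⟨ +-mono-≤-< (*-monoʳ-≤ W w≤a) (n<1+n 1) ⟩
      W * a + 2      ∎) p) ,
    ≮⇒≥ (λ a+h<w → <⇒≱ (begin-strict
      -- The interval ends exactly 1 before the start of vertex `a + h + 1`.
      W * a + 2 + (W * h + short n)      <⟨ n<1+n _ ⟩
      suc (W * a + 2 + (W * h + short n)) ≡⟨ solve₁ W a h (short n) ⟩
      W * (a + h) + W                    ≡⟨ +-comm _ W ⟩
      W + W * (a + h)                    ≡⟨ *-suc W (a + h) ⟨
      W * suc (a + h)                    ≤⟨ *-monoʳ-≤ W a+h<w ⟩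
      W * w                              ∎) q)
    where
    W = wide n
    solve₁ : ∀ W a h s → suc (W * a + 2 + (W * h + s)) ≡ W * (a + h) + (s + 3)
    solve₁ = solve-∀

  middle⇐ : ∀ {n a h w} → a < w → w ≤ a + h → wide n * a + 2 ≤ wide n * w + 1 ×
            wide n * w ≤ wide n * a + 2 + (wide n * h + short n)
  middle⇐ {n} {a} {h} {w} a<w w≤a+h =
    (begin
      W * a + 2                          ≤⟨ +-monoʳ-≤ (W * a) (≤-trans (n≤1+n 2) (m≤n+m 3 (short n))) ⟩
      W * a + W                          ≡⟨ +-comm (W * a) W ⟩
      W + W * a                          ≡⟨ *-suc W a ⟨
      W * suc a                          ≤⟨ *-monoʳ-≤ W a<w ⟩
      W * w                              ≤⟨ m≤m+n _ 1 ⟩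
      W * w + 1                          ∎) ,
    (begin
      W * w                              ≤⟨ *-monoʳ-≤ W w≤a+h ⟩
      W * (a + h)                        ≤⟨ m≤m+n _ (2 + short n) ⟩
      W * (a + h) + (2 + short n)        ≡⟨ solve₁ W a h (short n) ⟩
      W * a + 2 + (W * h + short n)      ∎)
    where
    W = wide n
    solve₁ : ∀ W a h s → W * (a + h) + (2 + s) ≡ W * a + 2 + (W * h + s)
    solve₁ = solve-∀

  -- On track 0 every copy contains the point `3 * n + 2`.
  pr-meets-pr : ∀ {n M} u v c u′ v′ c′ → Meets (prAt n M u v c) (prAt n M u′ v′ c′)
  pr-meets-pr {n} u v c u′ v′ c′ = zero , crosses u v u′ v′ , crosses u′ v′ u v
    where
    crosses : ∀ u v u′ v′ → 3 * (n ∸ u ⊓ v) + 2 ≤ 3 * (n ∸ u′ ⊓ v′) + 2 + (wide n * gap u′ v′ + short n)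
    crosses u v u′ v′ = begin
      3 * (n ∸ u ⊓ v) + 2                                       ≤⟨ +-monoˡ-≤ 2 (*-monoʳ-≤ 3 (m∸n≤m n (u ⊓ v))) ⟩
      3 * n + 2                                                 ≡⟨ +-comm (3 * n) 2 ⟩
      2 + 3 * n                                                 ≤⟨ +-mono-≤ (m≤n+m 2 (3 * (n ∸ u′ ⊓ v′)))
                                                                     (≤-trans (n≤1+n _) (m≤n+m (short n) (wide n * gap u′ v′))) ⟩
      3 * (n ∸ u′ ⊓ v′) + 2 + (wide n * gap u′ v′ + short n)    ∎

  pr-meets-vert⇒ : ∀ {n M u v c w} → Meets (prAt n M u v c) (vertAt n M w) →
                   w < u ⊓ v ⊎ (u ⊓ v < w × w < u ⊔ v) ⊎ u ⊔ v < w
  pr-meets-vert⇒ {n} {u = u} {v} {w = w} (zero , p , q) =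
    inj₁ (≰⇒> λ a≤w → <⇒≱ (thrice-< {n ∸ u ⊓ v} {n ∸ w} p) (∸-monoʳ-≤ n a≤w))
  pr-meets-vert⇒ {n} {u = u} {v} (suc zero , p , q) with middle⇒ {n} p q
  ... | a<w , w≤ = inj₂ (inj₁ (a<w , between⇒ {b = u ⊔ v} a<w w≤))
  pr-meets-vert⇒ {u = u} {v} (suc (suc zero) , p , q) = inj₂ (inj₂ (thrice-< p))

  pr-meets-vert⇐ : ∀ {n M u v c w} → u < n → w < n →
                   w < u ⊓ v ⊎ (u ⊓ v < w × w < u ⊔ v) ⊎ u ⊔ v < w →
                   Meets (prAt n M u v c) (vertAt n M w)
  pr-meets-vert⇐ {n} {u = u} {v} {w = w} u<n w<n (inj₁ w<a) =
    zero , <-thrice (∸-monoʳ-< w<a (≤-trans (m⊓n≤m u v) (<⇒≤ u<n))) , reach {x = n ∸ u ⊓ v} (gap u v) (m∸n≤m n w)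
  pr-meets-vert⇐ {n} {u = u} {v} u<n w<n (inj₂ (inj₁ (a<w , w<b))) =
    suc zero , middle⇐ {n} a<w (between⇐ a<w w<b)
  pr-meets-vert⇐ {n} {u = u} {v} u<n w<n (inj₂ (inj₂ b<w)) =
    suc (suc zero) , <-thrice b<w , reach {x = u ⊔ v} (gap u v) (<⇒≤ w<n)

  ends⇒ : ∀ {u v w} → w ≡ u ⊓ v ⊎ w ≡ u ⊔ v → w ≡ u ⊎ w ≡ v
  ends⇒ {u} {v} (inj₁ refl) = ⊓-sel u v
  ends⇒ {u} {v} (inj₂ refl) = ⊔-sel u v

  ends⇐ : ∀ {u v w} → w ≡ u ⊎ w ≡ v → w ≡ u ⊓ v ⊎ w ≡ u ⊔ v
  ends⇐ {u} {v} e with ≤-total u v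
  ends⇐ (inj₁ refl) | inj₁ u≤v = inj₁ (sym (m≤n⇒m⊓n≡m u≤v))
  ends⇐ (inj₂ refl) | inj₁ u≤v = inj₂ (sym (m≤n⇒m⊔n≡n u≤v))
  ends⇐ (inj₁ refl) | inj₂ v≤u = inj₂ (sym (m≥n⇒m⊔n≡m v≤u))
  ends⇐ (inj₂ refl) | inj₂ v≤u = inj₁ (sym (m≥n⇒m⊓n≡n v≤u))

  avoids⇒ : ∀ {a b w} → ¬ (w < a ⊎ (a < w × w < b) ⊎ b < w) → w ≡ a ⊎ w ≡ b
  avoids⇒ {a} {b} {w} ¬side with <-cmp w a
  ... | tri< w<a _ _ = contradiction (inj₁ w<a) ¬side
  ... | tri≈ _ w≡a _ = inj₁ w≡a
  ... | tri> _ _ a<w with <-cmp w b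
  ... | tri< w<b _ _ = contradiction (inj₂ (inj₁ (a<w , w<b))) ¬side
  ... | tri≈ _ w≡b _ = inj₂ w≡b
  ... | tri> _ _ b<w = contradiction (inj₂ (inj₂ b<w)) ¬side

  avoids⇐ : ∀ {a b w} → a ≤ b → w ≡ a ⊎ w ≡ b → ¬ (w < a ⊎ (a < w × w < b) ⊎ b < w)
  avoids⇐ a≤b (inj₁ refl) (inj₁ p)              = n≮n _ p
  avoids⇐ a≤b (inj₁ refl) (inj₂ (inj₁ (p , _))) = n≮n _ p
  avoids⇐ a≤b (inj₁ refl) (inj₂ (inj₂ p))       = <⇒≱ p a≤b
  avoids⇐ a≤b (inj₂ refl) (inj₁ p)              = <⇒≱ p a≤b
  avoids⇐ a≤b (inj₂ refl) (inj₂ (inj₁ (_ , p))) = n≮n _ p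
  avoids⇐ a≤b (inj₂ refl) (inj₂ (inj₂ p))       = n≮n _ p

  vert-vert : ∀ {n M u} → suc u < n → ¬ Meets (vertAt n M u) (vertAt n M (suc u))
  vert-vert {n} {u = u} u+1<n (zero , p , q) = <⇒≱ (begin-strict
    3 * (n ∸ suc u) + 1      <⟨ +-monoʳ-< (3 * (n ∸ suc u)) (s≤s (s≤s z≤n)) ⟩
    3 * (n ∸ suc u) + 3      ≡⟨ +-comm _ 3 ⟩
    3 + 3 * (n ∸ suc u)      ≡⟨ *-suc 3 (n ∸ suc u) ⟨
    3 * suc (n ∸ suc u)      ≤⟨ *-monoʳ-≤ 3 (∸-monoʳ-< (n<1+n u) (<⇒≤ u+1<n)) ⟩
    3 * (n ∸ u)              ∎) p
  vert-vert {n} {u = u} u+1<n (suc zero , p , q) = <⇒≱ (begin-strict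
    wide n * u + 1           <⟨ +-monoʳ-< (wide n * u) (≤-trans (n≤1+n 2) (m≤n+m 3 (short n))) ⟩
    wide n * u + wide n      ≡⟨ +-comm _ (wide n) ⟩
    wide n + wide n * u      ≡⟨ *-suc (wide n) u ⟨
    wide n * suc u           ∎) q
  vert-vert {u = u} u+1<n (suc (suc zero) , p , q) = <⇒≱ (begin-strict
    3 * u + 1                <⟨ +-monoʳ-< (3 * u) (s≤s (s≤s z≤n)) ⟩
    3 * u + 3                ≡⟨ +-comm _ 3 ⟩
    3 + 3 * u                ≡⟨ *-suc 3 u ⟨
    3 * suc u                ∎) q

  geometry : Geometry
  geometry = record
    { tracks = 3
    ; co     = true
    ; vertAt = vertAt
    ; prAt   = prAt
    ; vertAt-positive = λ _ _ _ → z<s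
    ; prAt-positive   = λ n M u v c → ≤-trans z<s (m≤n+m (short n) (wide n * gap u v))
    ; pr-pr     = λ {n} {M} {u} {v} {c} {u′} {v′} {c′} _ _ _ _ _ _ apart →
                    contradiction (pr-meets-pr {n} {M} u v c u′ v′ c′) apart
    ; pr-vert   = λ {n} {M} {u} {v} {c} {w} u< v< c< w< → mk⇔
        (λ apart → ends⇒ {u} {v} (avoids⇒ (apart ∘ pr-meets-vert⇐ {n} {M} {u} {v} {c} u< w<)))
        (λ end → avoids⇐ (m⊓n≤m⊔n u v) (ends⇐ {u} {v} end) ∘ pr-meets-vert⇒ {n} {M} {u} {v} {c})
    ; vert-vert = λ {n} {M} _ → vert-vert {n} {M}
    }

-- Expressions

product : Val → Val → Val
product u v = int (toℤ u ℤ.* toℤ v)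

bit : Bool → ℕ
bit b = if b then 1 else 0

module _ {m : ℕ} where

  notE : Expr m → Expr m
  notE e = sub (lit (ℤ.+ 1)) e

  andE orE equalE : Expr m → Expr m → Expr m
  andE d e   = mul d e
  orE d e    = notE (andE (notE d) (notE e))
  equalE d e = andE (leq d e) (leq e d)

  record Denotes (s : Store m) (e : Expr m) (a : ℕ) : Set where
    constructor denotes
    field
      value : eval e s ≡ int (ℤ.+ a)
  open Denotes public

  record Says (s : Store m) (e : Expr m) (b : Bool) : Set where
    constructor says
    field
      truth : eval e s ≡ fromBool b
  open Says public

  module _ {s : Store m} where

    denotes-lit : ∀ {a} → Denotes s (lit (ℤ.+ a)) a
    denotes-lit = denotes refl

    denotes-add : ∀ {d e a b} → Denotes s d a → Denotes s e b → Denotes s (add d e) (a + b)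
    denotes-add (denotes p) (denotes q) .value rewrite p | q = refl

    denotes-mul : ∀ {d e a b} → Denotes s d a → Denotes s e b → Denotes s (mul d e) (a * b)
    denotes-mul {a = a} {b} (denotes p) (denotes q) .value rewrite p | q = cong int (sym (ℤ.pos-* a b))

    denotes-sub : ∀ {d e a b} → b ≤ a → Denotes s d a → Denotes s e b → Denotes s (sub d e) (a ∸ b)
    denotes-sub {a = a} {b} b≤a (denotes p) (denotes q) .value rewrite p | q =
      cong int (trans (ℤ.m-n≡m⊖n a b) (ℤ.⊖-≥ b≤a))

    denotes-cong : ∀ {e a b} → a ≡ b → Denotes s e a → Denotes s e b
    denotes-cong refl p = p

    says-leq : ∀ {d e a b} → Denotes s d a → Denotes s e b → Says s (leq d e) (a ≤ᵇ b)
    says-leq (denotes p) (denotes q) .truth rewrite p | q = refl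

    says-not : ∀ {e b} → Says s e b → Says s (notE e) (not b)
    says-not {b = true}  (says p) .truth rewrite p = refl
    says-not {b = false} (says p) .truth rewrite p = refl

    says-and : ∀ {d e a b} → Says s d a → Says s e b → Says s (andE d e) (a ∧ b)
    says-and {a = true}  {true}  (says p) (says q) .truth = cong₂ product p q
    says-and {a = true}  {false} (says p) (says q) .truth = cong₂ product p q
    says-and {a = false} {true}  (says p) (says q) .truth = cong₂ product p q
    says-and {a = false} {false} (says p) (says q) .truth = cong₂ product p q

    says-or : ∀ {d e a b} → Says s d a → Says s e b → Says s (orE d e) (a ∨ b)
    says-or {a = true}  p q = says-not (says-and (says-not p) (says-not q))
    says-or {a = false} {b} p q = subst (Says s _) (not-involutive b)
      (says-not (says-and (says-not p) (says-not q)))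

    says-equal : ∀ {d e a b} → Denotes s d a → Denotes s e b → Says s (equalE d e) (equalᵇ a b)
    says-equal p q = says-and (says-leq p q) (says-leq q p)

    says⇒denotes : ∀ {e b} → Says s e b → Denotes s e (bit b)
    says⇒denotes {b = true}  (says p) = denotes p
    says⇒denotes {b = false} (says p) = denotes p

truthy-fromBool : ∀ b → truthy (fromBool b) ≡ b
truthy-fromBool true  = refl
truthy-fromBool false = refl

encodeRep : ∀ {t} → Placement t → Val
encodeRep (s , l) = encodeFamily λ i → pair (int (ℤ.+ s i)) (int (ℤ.+ (s i + l)))

repE : ∀ {m} t → (Fin t → Expr m) → Expr m → Expr m
repE zero    s l = lit (ℤ.+ 0)
repE (suc t) s l = cons (cons (s zero) (add (s zero) l)) (repE t (s ∘ suc) l)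

repE-correct : ∀ {m t} {σ : Store m} {sE : Fin t → Expr m} {lE} {s : Fin t → ℕ} {l} →
               (∀ i → Denotes σ (sE i) (s i)) → Denotes σ lE l →
               eval (repE t sE lE) σ ≡ encodeRep (s , l)
repE-correct {t = zero}  ps pl = refl
repE-correct {t = suc t} ps pl = cong₂ pair
  (cong₂ pair (value (ps zero)) (value (denotes-add (ps zero) pl))) (repE-correct (ps ∘ suc) pl)

meetsᵇ : ∀ {t} → Placement t → Placement t → Bool
meetsᵇ {zero}  _ _ = false
meetsᵇ {suc t} (s , l) (s′ , l′) =
  (s zero ≤ᵇ s′ zero + l′) ∧ (s′ zero ≤ᵇ s zero + l) ∨ meetsᵇ (s ∘ suc , l) (s′ ∘ suc , l′)

meetsE : ∀ {m} → ℕ → Expr m → Expr m → Expr m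
meetsE zero    x y = lit (ℤ.+ 0)
meetsE (suc t) x y =
  orE (andE (leq (hd (hd x)) (tl (hd y))) (leq (hd (hd y)) (tl (hd x)))) (meetsE t (tl x) (tl y))

meetsE-correct : ∀ {m t} {σ : Store m} {x y} (p p′ : Placement t) →
                 eval x σ ≡ encodeRep p → eval y σ ≡ encodeRep p′ →
                 Says σ (meetsE t x y) (meetsᵇ p p′)
meetsE-correct {t = zero}  _ _ _ _ = says refl
meetsE-correct {t = suc t} (s , l) (s′ , l′) px py = says-or
  (says-and
    (says-leq (denotes (cong (fst ∘ fst) px)) (denotes (cong (snd ∘ fst) py)))
    (says-leq (denotes (cong (fst ∘ fst) py)) (denotes (cong (snd ∘ fst) px))))
  (meetsE-correct (s ∘ suc , l) (s′ ∘ suc , l′) (cong snd px) (cong snd py))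

-- Registers and the expressions for both drawings

registers : ℕ
registers = 14

io rows row rN rM rU rV rC acc outer inner rowAcc matAcc repAcc : Fin registers
io     = # 0
rows   = # 1
row    = # 2
rN     = # 3
rM     = # 4
rU     = # 5
rV     = # 6
rC     = # 7
acc    = # 8
outer  = # 9
inner  = # 10
rowAcc = # 11
matAcc = # 12
repAcc = # 13

-- Register x stays below X ^ lookup exponents x; larger values would also do.
exponents : Vec ℕ registers
exponents = 100 ∷ 7 ∷ 7 ∷ 2 ∷ 2 ∷ 2 ∷ 2 ∷ 2 ∷ 64 ∷ 64 ∷ 64 ∷ 10 ∷ 20 ∷ 64 ∷ []

record Holds (s : Store registers) (n M u v c : ℕ) : Set where
  field
    holds-N : Denotes s (var rN) n
    holds-M : Denotes s (var rM) M
    holds-U : Denotes s (var rU) u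
    holds-V : Denotes s (var rV) v
    holds-C : Denotes s (var rC) c

blockE vertKeyE prKeyE swappedKeyE : Expr registers
blockE   = mul (add (lit (ℤ.+ 1)) (var rN)) (var rM)
vertKeyE = add (mul (var rU) blockE) (lit (ℤ.+ 0))
prKeyE   = add (mul (var rU) blockE) (add (mul (add (lit (ℤ.+ 1)) (var rV)) (var rM)) (var rC))
swappedKeyE = add (mul (var rV) blockE) (add (mul (add (lit (ℤ.+ 1)) (var rU)) (var rM)) (var rC))

record Drawing : Set where
  field
    geometry : Geometry
  open Geometry geometry public
  field
    vertStartE prStartE : Fin tracks → Expr registers
    vertLengthE prLengthE : Expr registers

  -- An item carries its key next to its intervals, so that the program can tell whether two items
  -- are the same by comparing single numbers.
  vertItemE : Expr registers
  vertItemE = cons vertKeyE (repE tracks vertStartE vertLengthE)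

  prItemE : Expr registers
  prItemE = cons prKeyE (repE tracks prStartE prLengthE)

  field
    vertStartE-correct  : ∀ {s n M u v c} → Holds s n M u v c → u < n →
                          ∀ i → Denotes s (vertStartE i) (proj₁ (vertAt n M u) i)
    vertLengthE-correct : ∀ {s n M u v c} → Holds s n M u v c →
                          Denotes s vertLengthE (proj₂ (vertAt n M u))
    prStartE-correct    : ∀ {s n M u v c} → Holds s n M u v c → u < n →
                          ∀ i → Denotes s (prStartE i) (proj₁ (prAt n M u v c) i)
    prLengthE-correct   : ∀ {s n M u v c} → Holds s n M u v c →
                          Denotes s prLengthE (proj₂ (prAt n M u v c))
    -- A closed inequality, decided by evaluation. A list of at most `X ^ 4` items of exponent 50
    -- has exponent 56, within the 64 allotted to `acc`.
    vertItemE-small     : magExponent exponents vertItemE ≤ 50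
    prItemE-small       : magExponent exponents prItemE ≤ 50

module _ {s n M u v c} (holds : Holds s n M u v c) where

  open Holds holds

  denotes-block : Denotes s blockE (block n M)
  denotes-block = denotes-mul (denotes-add denotes-lit holds-N) holds-M

  denotes-vertKey : Denotes s vertKeyE (u * block n M + 0)
  denotes-vertKey = denotes-add (denotes-mul holds-U denotes-block) denotes-lit

  denotes-prKey : Denotes s prKeyE (key n M u v c)
  denotes-prKey = denotes-add (denotes-mul holds-U denotes-block)
    (denotes-add (denotes-mul (denotes-add denotes-lit holds-V) holds-M) holds-C)

  denotes-swappedKey : Denotes s swappedKeyE (key n M v u c)
  denotes-swappedKey = denotes-add (denotes-mul holds-V denotes-block)
    (denotes-add (denotes-mul (denotes-add denotes-lit holds-U) holds-M) holds-C)

drawing₂ : Drawing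
drawing₂ = record
  { geometry    = TwoTracks.geometry
  ; vertStartE  = λ _ → mul (lit (ℤ.+ 2)) (mul (var rU) blockE)
  ; vertLengthE = mul (lit (ℤ.+ 2)) blockE
  ; prStartE    = λ { zero    → mul (lit (ℤ.+ 2)) prKeyE
                    ; (suc _) → mul (lit (ℤ.+ 2)) swappedKeyE }
  ; prLengthE   = lit (ℤ.+ 1)
  ; vertStartE-correct  = λ holds _ _ → denotes-mul denotes-lit
                            (denotes-mul (Holds.holds-U holds) (denotes-block holds))
  ; vertLengthE-correct = λ holds → denotes-mul denotes-lit (denotes-block holds)
  ; prStartE-correct    = λ { holds _ zero       → denotes-mul denotes-lit (denotes-prKey holds)
                            ; holds _ (suc zero) → denotes-mul denotes-lit (denotes-swappedKey holds) }
  ; prLengthE-correct   = λ _ → denotes-lit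
  ; vertItemE-small     = ≤ᵇ⇒≤ _ _ tt
  ; prItemE-small       = ≤ᵇ⇒≤ _ _ tt
  }

-- Expressions cannot branch, so minimum and maximum weight `rU` and `rV` by the bit of a comparison
-- and by its negation.
minE maxE gapE shortE wideE : Expr registers
minE   = add (mul (var rU) (leq (var rU) (var rV))) (mul (var rV) (notE (leq (var rU) (var rV))))
maxE   = add (mul (var rV) (leq (var rU) (var rV))) (mul (var rU) (notE (leq (var rU) (var rV))))
gapE   = sub (add maxE (leq maxE minE)) (add (lit (ℤ.+ 1)) minE)
shortE = add (lit (ℤ.+ 1)) (mul (lit (ℤ.+ 3)) (var rN))
wideE  = add shortE (lit (ℤ.+ 3))

select : ∀ u v b → (b ≡ true → u ≤ v) → (b ≡ false → v ≤ u) →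
         u * bit b + v * bit (not b) ≡ u ⊓ v × v * bit b + u * bit (not b) ≡ u ⊔ v
select u v true  u≤v _ = pick u v (sym (m≤n⇒m⊓n≡m (u≤v refl))) , pick v u (sym (m≤n⇒m⊔n≡n (u≤v refl)))
  where
  pick : ∀ x y {z} → x ≡ z → x * 1 + y * 0 ≡ z
  pick x y refl rewrite *-zeroʳ y = trans (+-identityʳ _) (*-identityʳ x)
select u v false _ v≤u = pick v u (sym (m≥n⇒m⊓n≡n (v≤u refl))) , pick u v (sym (m≥n⇒m⊔n≡m (v≤u refl)))
  where
  pick : ∀ x y {z} → x ≡ z → y * 0 + x * 1 ≡ z
  pick x y refl rewrite *-zeroʳ y = *-identityʳ x

selected : ∀ u v → u * bit (u ≤ᵇ v) + v * bit (not (u ≤ᵇ v)) ≡ u ⊓ v ×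
                   v * bit (u ≤ᵇ v) + u * bit (not (u ≤ᵇ v)) ≡ u ⊔ v
selected u v = select u v (u ≤ᵇ v) (λ eq → ≤ᵇ⇒≤ u v (subst T (sym eq) tt))
  (λ eq → ≰⇒≥ λ u≤v → subst T eq (≤⇒≤ᵇ u≤v))

-- The machine subtracts without truncation. The added bit is 1 exactly when `a` and `b` coincide,
-- the only case in which `b ∸ suc a` truncates, and there it makes the difference 0.
gap-formula : ∀ {a b} → a ≤ b → (b + bit (b ≤ᵇ a)) ∸ (1 + a) ≡ b ∸ suc a × 1 + a ≤ b + bit (b ≤ᵇ a)
gap-formula {a} {b} a≤b with b ≤ᵇ a in eq
... | true  rewrite ≤-antisym a≤b (≤ᵇ⇒≤ b a (subst T (sym eq) tt)) | +-comm b 1 =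
  trans (n∸n≡0 b) (sym (m≤n⇒m∸n≡0 (n≤1+n b))) , ≤-refl
... | false rewrite +-identityʳ b = refl , ≰⇒> λ b≤a → subst T eq (≤⇒≤ᵇ b≤a)

module _ {s n M u v c} (holds : Holds s n M u v c) where

  open Holds holds
  open ThreeTracks

  private
    u≤v : Denotes s (leq (var rU) (var rV)) (bit (u ≤ᵇ v))
    u≤v = says⇒denotes (says-leq holds-U holds-V)

    u≰v : Denotes s (notE (leq (var rU) (var rV))) (bit (not (u ≤ᵇ v)))
    u≰v = says⇒denotes (says-not (says-leq holds-U holds-V))

  denotes-min : Denotes s minE (u ⊓ v)
  denotes-min = denotes-cong (proj₁ (selected u v))
    (denotes-add (denotes-mul holds-U u≤v) (denotes-mul holds-V u≰v))

  denotes-max : Denotes s maxE (u ⊔ v)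
  denotes-max = denotes-cong (proj₂ (selected u v))
    (denotes-add (denotes-mul holds-V u≤v) (denotes-mul holds-U u≰v))

  denotes-gap : Denotes s gapE (gap u v)
  denotes-gap = let formula , fits = gap-formula (m⊓n≤m⊔n u v) in
    denotes-cong formula (denotes-sub fits
      (denotes-add denotes-max (says⇒denotes (says-leq denotes-max denotes-min)))
      (denotes-add denotes-lit denotes-min))

  denotes-short : Denotes s shortE (short n)
  denotes-short = denotes-add denotes-lit (denotes-mul denotes-lit holds-N)

  denotes-wide : Denotes s wideE (wide n)
  denotes-wide = denotes-add denotes-short denotes-lit

drawing₃ : Drawing
drawing₃ = record
  { geometry    = ThreeTracks.geometry
  ; vertStartE  = λ { zero          → mul (lit (ℤ.+ 3)) (sub (var rN) (var rU))
                    ; (suc zero)    → mul wideE (var rU)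
                    ; (suc (suc _)) → mul (lit (ℤ.+ 3)) (var rU) }
  ; vertLengthE = lit (ℤ.+ 1)
  ; prStartE    = λ { zero          → add (mul (lit (ℤ.+ 3)) (sub (var rN) minE)) (lit (ℤ.+ 2))
                    ; (suc zero)    → add (mul wideE minE) (lit (ℤ.+ 2))
                    ; (suc (suc _)) → add (mul (lit (ℤ.+ 3)) maxE) (lit (ℤ.+ 2)) }
  ; prLengthE   = add (mul wideE gapE) shortE
  ; vertStartE-correct  = λ
      { holds u<n zero             → let open Holds holds in
          denotes-mul denotes-lit (denotes-sub (<⇒≤ u<n) holds-N holds-U)
      ; holds u<n (suc zero)       → denotes-mul (denotes-wide holds) (Holds.holds-U holds)
      ; holds u<n (suc (suc zero)) → denotes-mul denotes-lit (Holds.holds-U holds) }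
  ; vertLengthE-correct = λ _ → denotes-lit
  ; prStartE-correct    = λ
      { {u = u} {v} holds u<n zero → denotes-add (denotes-mul denotes-lit
          (denotes-sub (≤-trans (m⊓n≤m u v) (<⇒≤ u<n)) (Holds.holds-N holds) (denotes-min holds))) denotes-lit
      ; holds u<n (suc zero)       → denotes-add (denotes-mul (denotes-wide holds) (denotes-min holds)) denotes-lit
      ; holds u<n (suc (suc zero)) → denotes-add (denotes-mul denotes-lit (denotes-max holds)) denotes-lit }
  ; prLengthE-correct   = λ holds → denotes-add
      (denotes-mul (denotes-wide holds) (denotes-gap holds)) (denotes-short holds)
  ; vertItemE-small     = ≤ᵇ⇒≤ _ _ tt
  ; prItemE-small       = ≤ᵇ⇒≤ _ _ tt
  }

-- The represented graph

concatMap-unique : ∀ {A B : Set} {f : A → List B} {xs} → Unique xs → (∀ x → Unique (f x)) →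
                   (∀ {x y z} → z ∈ᴸ f x → z ∈ᴸ f y → x ≡ y) → Unique (concatMap f xs)
concatMap-unique {xs = xs} unique each shared = Unique.concat⁺
  (All.map⁺ (All.universal each xs))
  (AllPairs.map⁺ (AllPairs.map (λ x≢y {_} (p , q) → x≢y (shared p q)) unique))

lookup-injective : ∀ {A : Set} {xs : List A} → Unique xs → ∀ {i j} →
                   List.lookup xs i ≡ List.lookup xs j → i ≡ j
lookup-injective {xs = x ∷ xs} (_ ∷ _)      {zero}  {zero}  _  = refl
lookup-injective {xs = x ∷ xs} (x∉ ∷ _)     {zero}  {suc j} eq = contradiction eq (All.lookup x∉ (∈-lookup j))
lookup-injective {xs = x ∷ xs} (x∉ ∷ _)     {suc i} {zero}  eq = contradiction (sym eq) (All.lookup x∉ (∈-lookup i))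
lookup-injective {xs = x ∷ xs} (_ ∷ unique) {suc i} {suc j} eq = cong suc (lookup-injective unique eq)

meetsᵇ⇔Meets : ∀ {t} (p p′ : Placement t) → T (meetsᵇ p p′) ⇔ Meets p p′
meetsᵇ⇔Meets {zero}  _ _ = mk⇔ (λ ()) (λ ())
meetsᵇ⇔Meets {suc t} (s , l) (s′ , l′) = mk⇔ ⇒ ⇐
  where
  ih = meetsᵇ⇔Meets (s ∘ suc , l) (s′ ∘ suc , l′)

  ⇒ : T (meetsᵇ (s , l) (s′ , l′)) → Meets (s , l) (s′ , l′)
  ⇒ t with to (T-∨ {(s zero ≤ᵇ s′ zero + l′) ∧ (s′ zero ≤ᵇ s zero + l)}) t
  ... | inj₁ pq = let p , q = to (T-∧ {s zero ≤ᵇ s′ zero + l′}) pq in zero , ≤ᵇ⇒≤ _ _ p , ≤ᵇ⇒≤ _ _ q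
  ... | inj₂ r with to ih r
  ... | i , p , q = suc i , p , q

  ⇐ : Meets (s , l) (s′ , l′) → T (meetsᵇ (s , l) (s′ , l′))
  ⇐ (zero  , p , q) = from (T-∨ {(s zero ≤ᵇ s′ zero + l′) ∧ (s′ zero ≤ᵇ s zero + l)})
    (inj₁ (from (T-∧ {s zero ≤ᵇ s′ zero + l′}) (≤⇒≤ᵇ p , ≤⇒≤ᵇ q)))
  ⇐ (suc i , p , q) = from (T-∨ {(s zero ≤ᵇ s′ zero + l′) ∧ (s′ zero ≤ᵇ s zero + l)})
    (inj₂ (from ih (i , p , q)))

meetsᵇ-sym : ∀ {t} (p p′ : Placement t) → meetsᵇ p p′ ≡ meetsᵇ p′ p
meetsᵇ-sym {zero}  _ _ = refl
meetsᵇ-sym {suc t} (s , l) (s′ , l′) =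
  cong₂ _∨_ (∧-comm (s zero ≤ᵇ s′ zero + l′) _) (meetsᵇ-sym (s ∘ suc , l) (s′ ∘ suc , l′))

intervals : ∀ {t} (p : Placement t) → 0 < proj₂ p → TrackInterval t
intervals (s , l) 0<l i = record
  { lo = ℤ.+ s i ; hi = ℤ.+ (s i + l) ; lo<hi = ℤ.+<+ (m<m+n (s i) 0<l) }

intervals-balanced : ∀ {t} (p : Placement t) 0<l → Balanced (intervals p 0<l)
intervals-balanced (s , l) 0<l i j = trans (length≡ i) (sym (length≡ j))
  where
  length≡ : ∀ i → Interval.length (intervals (s , l) 0<l i) ≡ ℤ.+ l
  length≡ i = trans (ℤ.m-n≡m⊖n (s i + l) (s i))
    (trans (ℤ.⊖-≥ (m≤m+n (s i) l)) (cong ℤ.+_ (m+n∸m≡n (s i) l)))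

Meets⇔Intersect : ∀ {t} (p p′ : Placement t) {0<l 0<l′} →
                  Meets p p′ ⇔ Intersect (intervals p 0<l) (intervals p′ 0<l′)
Meets⇔Intersect (s , l) (s′ , l′) = mk⇔
  -- The larger of the two left endpoints is a common point.
  (λ (i , p , q) → i , ℤ.+ (s i ⊔ s′ i) ,
    (ℤ.+≤+ (m≤m⊔n (s i) (s′ i)) , ℤ.+≤+ (⊔-lub (m≤m+n (s i) l) q)) ,
    (ℤ.+≤+ (m≤n⊔m (s i) (s′ i)) , ℤ.+≤+ (⊔-lub p (m≤m+n (s′ i) l′))))
  (λ (i , _ , (a , b) , (c , d)) → i , ℤ.drop‿+≤+ (ℤ.≤-trans a d) , ℤ.drop‿+≤+ (ℤ.≤-trans c b))

polar : Bool → Bool → Bool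
polar co b = if co then not b else b

polar⇔Joined : ∀ co {b P} → T b ⇔ P → T (polar co b) ⇔ Joined co P
polar⇔Joined false         b⇔P = b⇔P
polar⇔Joined true  {true}  b⇔P = mk⇔ (λ ()) (λ ¬P → ¬P (to b⇔P tt))
polar⇔Joined true  {false} b⇔P = mk⇔ (λ _ → from b⇔P) (λ _ → tt)

T-not : ∀ {b} → T (not b) ⇔ (¬ T b)
T-not {true}  = mk⇔ (λ ()) (λ ¬t → ¬t tt)
T-not {false} = mk⇔ (λ _ ()) (λ _ → tt)

module Cutting (D : Drawing) {n} (G : Graph n) (k : ℕ) where

  open Drawing D

  M : ℕ
  M = 2 + k

  placeOf : Label n → Placement tracks
  placeOf (vert u)   = vertAt n M (toℕ u)
  placeOf (pr u v c) = prAt n M (toℕ u) (toℕ v) c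

  placeOf-positive : ∀ ℓ → 0 < proj₂ (placeOf ℓ)
  placeOf-positive (vert u)   = vertAt-positive n (toℕ u) z<s
  placeOf-positive (pr u v c) = prAt-positive n M (toℕ u) (toℕ v) c

  keyOf : Label n → ℕ
  keyOf (vert u)   = toℕ u * block n M + 0
  keyOf (pr u v c) = key n M (toℕ u) (toℕ v) c

  keyOf-injective : ∀ {ℓ ℓ′} → Valid G M ℓ → Valid G M ℓ′ → keyOf ℓ ≡ keyOf ℓ′ → ℓ ≡ ℓ′
  keyOf-injective {vert u}   {vert u′}     _        _         eq =
    cong vert (toℕ-injective (proj₁ (digits-unique z<s z<s eq)))
  keyOf-injective {vert u}   {pr u′ v′ c′} _        (_ , c′<) eq =
    contradiction (proj₂ (digits-unique {toℕ u} {toℕ u′} {B = block n M} z<s (offset<block (toℕ<n v′) c′<) eq))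
      (<⇒≢ (0<offset (toℕ v′) c′<))
  keyOf-injective {pr u v c} {vert u′}     (_ , c<) _         eq =
    contradiction (proj₂ (digits-unique {toℕ u} {toℕ u′} (offset<block (toℕ<n v) c<) z<s eq))
      (>⇒≢ (0<offset (toℕ v) c<))
  keyOf-injective {pr u v c} {pr u′ v′ c′} (_ , c<) (_ , c′<) eq
    with key-injective {n} {M} {toℕ u} {toℕ v} {c} {toℕ u′} {toℕ v′} (toℕ<n v) c< (toℕ<n v′) c′< eq
  ... | p , q , refl with refl ← toℕ-injective p | refl ← toℕ-injective q = refl

  -- The keys keep a copy from being adjacent to itself.
  adjacentᵇ : Label n → Label n → Bool
  adjacentᵇ ℓ ℓ′ = polar co (meetsᵇ (placeOf ℓ) (placeOf ℓ′)) ∧ not (equalᵇ (keyOf ℓ) (keyOf ℓ′))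

  adjacent⇔ : ∀ ℓ ℓ′ → T (adjacentᵇ ℓ ℓ′) ⇔ (Joined co (Meets (placeOf ℓ) (placeOf ℓ′)) × keyOf ℓ ≢ keyOf ℓ′)
  adjacent⇔ ℓ ℓ′ = ⇔.trans T-∧ (polar⇔Joined co (meetsᵇ⇔Meets (placeOf ℓ) (placeOf ℓ′)) ×-⇔ ⇔.trans T-not
    (mk⇔ (λ ¬e eq → ¬e (subst (T ∘ equalᵇ (keyOf ℓ)) eq (equalᵇ-refl (keyOf ℓ)))) (λ k≢ e → k≢ (equalᵇ⇒≡ _ _ e))))

  adjacentᵇ-sym : ∀ ℓ ℓ′ → adjacentᵇ ℓ ℓ′ ≡ adjacentᵇ ℓ′ ℓ
  adjacentᵇ-sym ℓ ℓ′ = cong₂ (λ a b → polar co a ∧ not b)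
    (meetsᵇ-sym (placeOf ℓ) (placeOf ℓ′)) (∧-comm (keyOf ℓ ≤ᵇ keyOf ℓ′) _)

  adjacentᵇ-irrefl : ∀ ℓ → adjacentᵇ ℓ ℓ ≡ false
  adjacentᵇ-irrefl ℓ with adjacentᵇ ℓ ℓ in eq
  ... | false = refl
  ... | true  = contradiction refl (proj₂ (to (adjacent⇔ ℓ ℓ) (subst T (sym eq) tt)))

  -- Copies are listed downwards because the program counts `rC` down to 0; thus `labels` follows
  -- the order in which the items are produced.
  cell : Fin n → Fin n → List (Label n)
  cell u v = if linked G u v then List.map (pr u v) (downFrom M) else []

  cells : Fin n → List (Label n)
  cells u = vert u ∷ concatMap (cell u) (allFin n)

  labels : List (Label n)
  labels = concatMap cells (allFin n)

  ∈-cell⁻ : ∀ {u v ℓ} → ℓ ∈ᴸ cell u v → ∃ λ c → ℓ ≡ pr u v c × T (linked G u v) × c < M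
  ∈-cell⁻ {u} {v} p with linked G u v
  ... | true with c , c∈ , eq ← ∈-map⁻ (pr u v) p = c , eq , tt , ∈-downFrom⁻ c∈

  ∈-cell⁺ : ∀ {u v c} → T (linked G u v) → c < M → pr u v c ∈ᴸ cell u v
  ∈-cell⁺ {u} {v} uv c< with true ← linked G u v = ∈-map⁺ (pr u v) (∈-downFrom⁺ c<)

  ∈-cells⁻ : ∀ {u ℓ} → ℓ ∈ᴸ cells u → ℓ ≡ vert u ⊎ ∃ λ v → ℓ ∈ᴸ cell u v
  ∈-cells⁻ (here eq) = inj₁ eq
  ∈-cells⁻ {u} (there p) = inj₂ (Any.satisfied (∈-concatMap⁻ (cell u) {xs = allFin n} p))

  labels-valid : ∀ {ℓ} → ℓ ∈ᴸ labels → Valid G M ℓ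
  labels-valid p with u , p ← Any.satisfied (∈-concatMap⁻ cells {xs = allFin n} p) with ∈-cells⁻ p
  ... | inj₁ refl    = tt
  ... | inj₂ (v , q) with c , refl , valid ← ∈-cell⁻ {u} {v} q = valid

  labels-complete : ∀ ℓ → Valid G M ℓ → ℓ ∈ᴸ labels
  labels-complete (vert u)   _         = ∈-concatMap⁺ cells (Any.map (λ { refl → here refl }) (∈-allFin u))
  labels-complete (pr u v c) (uv , c<) = ∈-concatMap⁺ cells (Any.map
    (λ { refl → there (∈-concatMap⁺ (cell u) (Any.map (λ { refl → ∈-cell⁺ uv c< }) (∈-allFin v))) }) (∈-allFin u))

  labels-unique : Unique labels
  labels-unique = concatMap-unique (Unique.allFin⁺ n)
    (λ u → All.tabulate (λ { p refl → vert∉ u p }) ∷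
      concatMap-unique (Unique.allFin⁺ n) (cell-unique u) cell-shared)
    shared
    where
    vert∉ : ∀ u → ¬ (vert u ∈ᴸ concatMap (cell u) (allFin n))
    vert∉ u p with v , q ← Any.satisfied (∈-concatMap⁻ (cell u) {xs = allFin n} p)
      with _ , () , _ ← ∈-cell⁻ {u} {v} q

    cell-unique : ∀ u v → Unique (cell u v)
    cell-unique u v with linked G u v
    ... | true  = Unique.map⁺ (λ { refl → refl }) (Unique.downFrom⁺ M)
    ... | false = []

    cell-shared : ∀ {u v v′ ℓ} → ℓ ∈ᴸ cell u v → ℓ ∈ᴸ cell u v′ → v ≡ v′
    cell-shared {u} {v} {v′} p q
      with _ , refl , _ ← ∈-cell⁻ {u} {v} p | _ , refl , _ ← ∈-cell⁻ {u} {v′} q = refl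

    form : ∀ {u ℓ} → ℓ ∈ᴸ cells u → (ℓ ≡ vert u) ⊎ ∃ λ v → ∃ λ c → ℓ ≡ pr u v c
    form {u} p with ∈-cells⁻ p
    ... | inj₁ eq = inj₁ eq
    ... | inj₂ (v , q) with c , eq , _ ← ∈-cell⁻ {u} {v} q = inj₂ (v , c , eq)

    shared : ∀ {u u′ ℓ} → ℓ ∈ᴸ cells u → ℓ ∈ᴸ cells u′ → u ≡ u′
    shared p q with form p | form q
    ... | inj₁ refl           | inj₁ refl           = refl
    ... | inj₂ (_ , _ , refl) | inj₂ (_ , _ , refl) = refl

  N : ℕ
  N = List.length labels

  label : Fin N → Label n
  label = List.lookup labels

  label-valid : ∀ x → Valid G M (label x)
  label-valid x = labels-valid (∈-lookup x)

  H : Graph N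
  H = record
    { adj       = λ x y → adjacentᵇ (label x) (label y)
    ; symmetric = λ x y → adjacentᵇ-sym (label x) (label y)
    ; loopless  = λ x → adjacentᵇ-irrefl (label x)
    }

  keys-differ : ∀ {ℓ ℓ′} → Valid G M ℓ → Valid G M ℓ′ → ℓ ≢ ℓ′ → keyOf ℓ ≢ keyOf ℓ′
  keys-differ v v′ ℓ≢ℓ′ = ℓ≢ℓ′ ∘ keyOf-injective v v′

  isCutGraph : IsCutGraph G M H label
  isCutGraph = record
    { label-injective = lookup-injective labels-unique
    ; label-valid     = label-valid
    ; locate          = λ ℓ valid → let p = labels-complete ℓ valid in Any.index p , sym (lookup-index p)
    ; independent     = λ {x} {y} → independent (label x) (label y) (label-valid x) (label-valid y)
    ; incident        = λ {x} {y} → incident (label x) (label y) (label-valid x) (label-valid y)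
    ; consecutive     = λ {x} {y} → consecutive (label x) (label y) (label-valid x) (label-valid y)
    }
    where
    -- Stated for arbitrary labels, so that the equations can be matched, which they cannot be with
    -- `label x` in place of `ℓ`.
    independent : ∀ ℓ ℓ′ → Valid G M ℓ → Valid G M ℓ′ → ∀ {u v c u′ v′ c′} →
                  ℓ ≡ pr u v c → ℓ′ ≡ pr u′ v′ c′ → ¬ T (adjacentᵇ ℓ ℓ′)
    independent ℓ ℓ′ (_ , c<) (_ , c′<) {u} {v} {c} {u′} {v′} refl refl adj
      with joined , keys≢ ← to (adjacent⇔ ℓ ℓ′) adj
      with pr-pr (toℕ<n u) (toℕ<n v) c< (toℕ<n u′) (toℕ<n v′) c′< joined
    ... | p , q , refl with refl ← toℕ-injective p | refl ← toℕ-injective q = keys≢ refl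

    incident : ∀ ℓ ℓ′ → Valid G M ℓ → Valid G M ℓ′ → ∀ {u v c w} →
               ℓ ≡ pr u v c → ℓ′ ≡ vert w → T (adjacentᵇ ℓ ℓ′) ⇔ (w ≡ u ⊎ w ≡ v)
    incident ℓ ℓ′ valid@(_ , c<) valid′ {u} {v} {c} {w} refl refl = mk⇔
      (λ adj → ends (to meets (proj₁ (to (adjacent⇔ ℓ ℓ′) adj))))
      (λ { (inj₁ refl) → from (adjacent⇔ ℓ ℓ′) (from meets (inj₁ refl) , keys-differ {ℓ} {ℓ′} valid valid′ (λ ()))
         ; (inj₂ refl) → from (adjacent⇔ ℓ ℓ′) (from meets (inj₂ refl) , keys-differ {ℓ} {ℓ′} valid valid′ (λ ())) })
      where
      meets : Joined co (Meets (placeOf ℓ) (placeOf ℓ′)) ⇔ (toℕ w ≡ toℕ u ⊎ toℕ w ≡ toℕ v)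
      meets = pr-vert (toℕ<n u) (toℕ<n v) c< (toℕ<n w)

      ends : toℕ w ≡ toℕ u ⊎ toℕ w ≡ toℕ v → w ≡ u ⊎ w ≡ v
      ends (inj₁ p) = inj₁ (toℕ-injective p)
      ends (inj₂ p) = inj₂ (toℕ-injective p)

    consecutive : ∀ ℓ ℓ′ → Valid G M ℓ → Valid G M ℓ′ → ∀ {u w} →
                  ℓ ≡ vert u → ℓ′ ≡ vert w → toℕ w ≡ suc (toℕ u) → T (adjacentᵇ ℓ ℓ′)
    consecutive ℓ ℓ′ valid valid′ {u} {w} refl refl eq = from (adjacent⇔ ℓ ℓ′)
      ( subst (λ w → Joined co (Meets (vertAt n M (toℕ u)) (vertAt n M w))) (sym eq)
          (vert-vert z<s (subst (_< n) eq (toℕ<n w)))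
      , keys-differ {ℓ} {ℓ′} valid valid′ λ { refl → 1+n≢n (sym eq) })

  family : Fin N → TrackInterval tracks
  family x = intervals (placeOf (label x)) (placeOf-positive (label x))

  adjacent⇔Intersect : ∀ {x y} → x ≢ y → Adjacent H x y ⇔ Joined co (Intersect (family x) (family y))
  adjacent⇔Intersect {x} {y} x≢y = ⇔.trans (adjacent⇔ (label x) (label y)) (mk⇔
    (λ (joined , _) → transfer co (⇔.sym ⇔I) joined)
    (λ joined → transfer co ⇔I joined ,
       keys-differ (label-valid x) (label-valid y) (x≢y ∘ lookup-injective labels-unique)))
    where
    ⇔I = ⇔.sym (Meets⇔Intersect (placeOf (label x)) (placeOf (label y))
      {placeOf-positive (label x)} {placeOf-positive (label y)})

    transfer : ∀ co {P Q} → P ⇔ Q → Joined co P → Joined co Q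
    transfer false P⇔Q = to P⇔Q
    transfer true  P⇔Q = _∘ from P⇔Q

  -- Needed for the complement, where nonadjacency in `H` yields only a double negation of
  -- intersection.
  intersect? : ∀ x y → Dec (Intersect (family x) (family y))
  intersect? x y = map (⇔.trans (meetsᵇ⇔Meets _ _) (Meets⇔Intersect (placeOf (label x)) (placeOf (label y))
      {placeOf-positive (label x)} {placeOf-positive (label y)})) (T? _)

complement-adjacent⇔ : ∀ {n} (H : Graph n) {x y} → x ≢ y → Adjacent (complement H) x y ⇔ (¬ Adjacent H x y)
complement-adjacent⇔ H {x} {y} x≢y with x Fin.≟ y
... | yes x≡y = contradiction x≡y x≢y
... | no _    = ⇔.trans T-∧ (⇔.trans (mk⇔ proj₁ (_, tt)) T-not)

-- The reduction program

listOf : ∀ {A : Set} → (A → Val) → List A → Val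
listOf f []       = nil
listOf f (x ∷ xs) = pair (f x) (listOf f xs)

encodeFamily-lookup : ∀ {A : Set} (f : A → Val) xs → encodeFamily (f ∘ List.lookup xs) ≡ listOf f xs
encodeFamily-lookup f []       = refl
encodeFamily-lookup f (x ∷ xs) = cong (pair (f x)) (encodeFamily-lookup f xs)

encodeFamily-tabulate : ∀ {A : Set} {n} (f : A → Val) (g : Fin n → A) →
                        encodeFamily (f ∘ g) ≡ listOf f (List.tabulate g)
encodeFamily-tabulate {n = zero}  f g = refl
encodeFamily-tabulate {n = suc n} f g = cong (pair (f (g zero))) (encodeFamily-tabulate f (g ∘ suc))

listOf-cong : ∀ {A : Set} {f g : A → Val} → (∀ x → f x ≡ g x) → ∀ xs → listOf f xs ≡ listOf g xs
listOf-cong f≗g []       = refl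
listOf-cong f≗g (x ∷ xs) = cong₂ pair (f≗g x) (listOf-cong f≗g xs)

-- Accumulators only grow, so a bound on the final list bounds every intermediate one. The loop
-- invariants hence carry just the final bound.
mag-listOf-ʳ++ : ∀ {A : Set} (f : A → Val) xs {ys} → mag (listOf f ys) ≤ mag (listOf f (xs ʳ++ ys))
mag-listOf-ʳ++ f []            = ≤-refl
mag-listOf-ʳ++ f (x ∷ xs) {ys} =
  ≤-trans (m≤n⇒m≤1+n (m≤n+m (mag (listOf f ys)) (mag (f x)))) (mag-listOf-ʳ++ f xs)

mag-listOf : ∀ {A : Set} {f : A → Val} {b} {xs} → All (λ x → mag (f x) ≤ b) xs →
             mag (listOf f xs) ≤ suc (length xs * suc b)
mag-listOf []       = ≤-refl
mag-listOf {f = f} {b} {x ∷ xs} (p ∷ ps) = s≤s (begin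
  mag (f x) + mag (listOf f xs)        ≤⟨ +-mono-≤ p (mag-listOf ps) ⟩
  b + suc (length xs * suc b)          ≡⟨ +-suc b _ ⟩
  suc b + length xs * suc b            ∎)

All-ʳ++ : ∀ {A : Set} {P : A → Set} {xs ys} → All P xs → All P ys → All P (xs ʳ++ ys)
All-ʳ++ []       qs = qs
All-ʳ++ (p ∷ ps) qs = All-ʳ++ ps (p ∷ qs)

length-concatMap : ∀ {A B : Set} {f : A → List B} {b} xs → (∀ x → length (f x) ≤ b) →
                   length (concatMap f xs) ≤ length xs * b
length-concatMap []                   _  = z≤n
length-concatMap {f = f} (x ∷ xs) f≤ =
  ≤-trans (≤-reflexive (List.length-++ (f x))) (+-mono-≤ (f≤ x) (length-concatMap xs f≤))

-- Ties a counter register to the part of `allFin n` that remains to be scanned: the next vertex is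
-- the value `j` of the counter.
data Upwards {n} : ℕ → List (Fin n) → Set where
  []  : ∀ {j} → Upwards j []
  _∷_ : ∀ {j u us} → toℕ u ≡ j → Upwards (suc j) us → Upwards j (u ∷ us)

upwards-tabulate : ∀ {m n} j (f : Fin m → Fin n) → (∀ i → toℕ (f i) ≡ j + toℕ i) →
                   Upwards j (List.tabulate f)
upwards-tabulate {zero}  j f eq = []
upwards-tabulate {suc m} j f eq = trans (eq zero) (+-identityʳ j) ∷
  upwards-tabulate (suc j) (f ∘ suc) (λ i → trans (eq (suc i)) (+-suc j (toℕ i)))

upwards-allFin : ∀ n → Upwards 0 (allFin n)
upwards-allFin n = upwards-tabulate 0 id (λ _ → refl)

module Reducer (D : Drawing) where

  open Drawing D

  polarE : ∀ {m} → Bool → Expr m → Expr m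
  polarE co e = if co then notE e else e

  says-polar : ∀ {m} {s : Store m} co {e b} → Says s e b → Says s (polarE co e) (polar co b)
  says-polar false p = p
  says-polar true  p = says-not p

  adjacentE : Expr registers
  adjacentE = andE
    (polarE co (meetsE tracks (tl (hd (var outer))) (tl (hd (var inner)))))
    (notE (equalE (hd (hd (var outer))) (hd (hd (var inner)))))

  -- The vertices are counted first because placements and keys depend on `n`. The matrix is
  -- computed from the finished items alone: keys and intervals determine adjacency, so no label has
  -- to be decoded. `copies` leaves `rC` at 0, which restores the state in which the next cell
  -- starts.
  count copy copies chooseCell nextCell nextRow nextBit nextLine main : Code registers
  count      = rN := add (lit (ℤ.+ 1)) (var rN) ⨾ rows := tl (var rows)
  copy       = rC := sub (var rC) (lit (ℤ.+ 1)) ⨾ acc := cons prItemE (var acc)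
  copies     = while (var rC) copy
  chooseCell = cond (orE (hd (var row)) (equalE (var rU) (var rV))) (rC := var rM ⨾ copies) skip
  nextCell   = chooseCell ⨾ row := tl (var row) ⨾ rV := add (lit (ℤ.+ 1)) (var rV)
  nextRow    = row := hd (var rows) ⨾ acc := cons vertItemE (var acc) ⨾
               while (isPair (var row)) nextCell ⨾ rV := lit (ℤ.+ 0) ⨾
               rows := tl (var rows) ⨾ rU := add (lit (ℤ.+ 1)) (var rU)
  nextBit    = rowAcc := cons adjacentE (var rowAcc) ⨾ inner := tl (var inner)
  nextLine   = inner := var acc ⨾ while (isPair (var inner)) nextBit ⨾
               matAcc := cons (var rowAcc) (var matAcc) ⨾ rowAcc := lit (ℤ.+ 0) ⨾
               repAcc := cons (tl (hd (var outer))) (var repAcc) ⨾ outer := tl (var outer)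
  main       = rows := hd (var io) ⨾ while (isPair (var rows)) count ⨾
               rM := add (lit (ℤ.+ 2)) (tl (var io)) ⨾ rows := hd (var io) ⨾
               while (isPair (var rows)) nextRow ⨾ outer := var acc ⨾
               while (isPair (var outer)) nextLine ⨾
               io := cons (var matAcc) (cons (var repAcc)
                       (cons (tl (var io)) (mul (tl (var io)) (mul (tl (var io)) (var rM)))))

  program : Program
  program = record { extra = 13 ; code = main }

  -- Kept opaque: unfolded, the exponent is a huge normal form.
  abstract
    main-time : ℕ
    main-time = timeExponent exponents 4 main

    main-time-unfold : main-time ≡ timeExponent exponents 4 main
    main-time-unfold = refl

  module _ {n} (G : Graph n) (k : ℕ) (X : ℕ) (2≤X : 2 ≤ X) (n≤X : n ≤ X) (M≤X : 2 + k ≤ X) where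

    open Cutting D G k
    open Powers X 2≤X
    open Bounded exponents 4

    ≤X⇒⊑1 : ∀ {a} → a ≤ X → a ⊑ 1
    ≤X⇒⊑1 a≤X = bounded (≤-trans a≤X (≤-reflexive (sym (*-identityʳ X))))

    ≤X⇒⊑4 : ∀ {a} → a ≤ X → a ⊑ 4
    ≤X⇒⊑4 a≤X = ⊑-raise (s≤s z≤n) (≤X⇒⊑1 a≤X)

    ≤X⇒fits : ∀ {a} → a ≤ X → mag (int (ℤ.+ a)) ⊑ 2
    ≤X⇒fits a≤X = ⊑-suc (≤X⇒⊑1 a≤X)

    nil-fits : ∀ {b} → mag nil ⊑ b
    nil-fits = ⊑-raise z≤n 1⊑0

    head-fits : ∀ {u v b} → mag (pair u v) ⊑ b → mag u ⊑ b
    head-fits = ⊑-trans (m≤n⇒m≤1+n (m≤m+n _ _))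

    tail-fits : ∀ {u v b} → mag (pair u v) ⊑ b → mag v ⊑ b
    tail-fits {u} = ⊑-trans (m≤n⇒m≤1+n (m≤n+m _ (mag u)))

    suffix-fits : ∀ {A : Set} {f : A → Val} xs {ys b} → mag (listOf f (xs ʳ++ ys)) ⊑ b → mag (listOf f ys) ⊑ b
    suffix-fits {f = f} xs = ⊑-trans (mag-listOf-ʳ++ f xs)

    listOf-fits : ∀ {A : Set} {f : A → Val} {xs l b} → All (λ x → mag (f x) ⊑ b) xs → length xs ⊑ l →
                  mag (listOf f xs) ⊑ 0 ⊕ (l + (0 ⊕ b))
    listOf-fits fs len = ⊑-trans (mag-listOf (All.map bound fs)) (⊑-suc (⊑-product len (⊑-suc (bounded ≤-refl))))

    Rounds-end : ∀ {e c m s s′ s″} → s′ ≡ s″ → Rounds e c m s s′ → Rounds e c m s s″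
    Rounds-end refl rounds = rounds

    bitOf : Fin n → Fin n → Val
    bitOf u v = fromBool (Graph.adj G u v)

    rowOf : Fin n → Val
    rowOf u = listOf (bitOf u) (allFin n)

    matrix≡ : encodeGraph G ≡ listOf rowOf (allFin n)
    matrix≡ = trans (encodeFamily-tabulate _ id)
      (listOf-cong (λ u → encodeFamily-tabulate (bitOf u) id) (allFin n))

    item : Label n → Val
    item ℓ = pair (int (ℤ.+ keyOf ℓ)) (encodeRep (placeOf ℓ))

    -- The stores while counting (`stage₁`), collecting items (`stage₂`) and writing the output
    -- (`stage₃`). As `nil` is the integer 0, an untouched register is at once an empty list and a
    -- counter at 0, so the stages join without any initialisation.
    stage₁ : (x rs : Val) → ℕ → Store registers
    stage₁ x rs j =
      x ∷ rs ∷ nil ∷ int (ℤ.+ j) ∷ nil ∷ nil ∷ nil ∷ nil ∷ nil ∷ nil ∷ nil ∷ nil ∷ nil ∷ nil ∷ []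

    stage₂ : (x rs r : Val) (u v c : ℕ) → List (Label n) → Store registers
    stage₂ x rs r u v c ℓs =
      x ∷ rs ∷ r ∷ int (ℤ.+ n) ∷ int (ℤ.+ M) ∷ int (ℤ.+ u) ∷ int (ℤ.+ v) ∷ int (ℤ.+ c) ∷
      listOf item ℓs ∷ nil ∷ nil ∷ nil ∷ nil ∷ nil ∷ []

    stage₃ : (x os is ra ma re : Val) → List (Label n) → Store registers
    stage₃ x os is ra ma re ℓs =
      x ∷ nil ∷ nil ∷ int (ℤ.+ n) ∷ int (ℤ.+ M) ∷ int (ℤ.+ n) ∷ nil ∷ nil ∷
      listOf item ℓs ∷ os ∷ is ∷ ra ∷ ma ∷ re ∷ []

    holds₂ : ∀ {x rs r u v c ℓs} → Holds (stage₂ x rs r u v c ℓs) n M u v c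
    holds₂ = record
      { holds-N = denotes refl ; holds-M = denotes refl ; holds-U = denotes refl
      ; holds-V = denotes refl ; holds-C = denotes refl }

    eval-vertItem : ∀ {s v c} u → Holds s n M (toℕ u) v c → eval vertItemE s ≡ item (vert u)
    eval-vertItem u holds = cong₂ pair (value (denotes-vertKey holds))
      (repE-correct (vertStartE-correct holds (toℕ<n u)) (vertLengthE-correct holds))

    eval-prItem : ∀ {s c} u v → Holds s n M (toℕ u) (toℕ v) c → eval prItemE s ≡ item (pr u v c)
    eval-prItem u v holds = cong₂ pair (value (denotes-prKey holds))
      (repE-correct (prStartE-correct holds (toℕ<n u)) (prLengthE-correct holds))

    count-rounds : ∀ {x} us j → Upwards j us → j + length us ≤ n → mag (listOf rowOf us) ⊑ 7 →
                   Rounds (isPair (var rows)) count (length us)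
                     (stage₁ x (listOf rowOf us) j) (stage₁ x nil (j + length us))
    count-rounds {x} [] j [] _ _ rewrite +-identityʳ j = done refl
    count-rounds (u ∷ us) j (_ ∷ up) j+≤n fits = more refl
      (Run-assign rN _ refl (≤X⇒fits (≤-trans (≤-trans (s≤s (m≤m+n j _)) suc≤) n≤X)) ⨾ᴿ
       Run-assign rows _ refl (tail-fits fits))
      (Rounds-end (cong (stage₁ _ nil) (sym (+-suc j (length us))))
        (count-rounds us (suc j) up suc≤ (tail-fits fits)))
      where
      suc≤ : suc j + length us ≤ n
      suc≤ = ≤-trans (≤-reflexive (sym (+-suc j (length us)))) j+≤n

    copies-rounds : ∀ {x rs r} u v c ℓs → c ≤ M →
                    mag (listOf item (List.map (pr u v) (downFrom c) ʳ++ ℓs)) ⊑ 64 →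
                    Rounds (var rC) copy c (stage₂ x rs r (toℕ u) (toℕ v) c ℓs)
                      (stage₂ x rs r (toℕ u) (toℕ v) 0 (List.map (pr u v) (downFrom c) ʳ++ ℓs))
    copies-rounds u v zero    ℓs _  _    = done refl
    copies-rounds u v (suc c) ℓs c< fits = more refl
      (Run-assign rC _ refl (≤X⇒fits (≤-trans (<⇒≤ c<) M≤X)) ⨾ᴿ
       Run-assign acc _ (cong (λ i → pair i (listOf item ℓs)) (eval-prItem u v holds₂))
         (suffix-fits (List.map (pr u v) (downFrom c)) fits))
      (copies-rounds u v c (pr u v c ∷ ℓs) (<⇒≤ c<) fits)

    says-linked : ∀ {x rs r} u v ℓs → Says (stage₂ x rs (pair (bitOf u v) r) (toℕ u) (toℕ v) 0 ℓs)
                  (orE (hd (var row)) (equalE (var rU) (var rV))) (linked G u v)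
    says-linked u v ℓs = says-or (says refl) (says-equal (denotes refl) (denotes refl))

    says-guard : ∀ {s : Store registers} {e b b′} → Says s e b → b ≡ b′ → truthy (eval e s) ≡ b′
    says-guard (says p) eq = trans (cong truthy p) (trans (truthy-fromBool _) eq)

    run-chooseCell : ∀ {x rs r} u v ℓs → mag (listOf item (cell u v ʳ++ ℓs)) ⊑ 64 →
                     Run chooseCell (stage₂ x rs (pair (bitOf u v) r) (toℕ u) (toℕ v) 0 ℓs)
                       (stage₂ x rs (pair (bitOf u v) r) (toℕ u) (toℕ v) 0 (cell u v ʳ++ ℓs))
    run-chooseCell {x} {rs} {r} u v ℓs = choose (linked G u v) (says-guard (says-linked {x} {rs} {r} u v ℓs) refl)
      where
      start = stage₂ x rs (pair (bitOf u v) r) (toℕ u) (toℕ v) 0 ℓs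

      -- The Boolean is abstracted because both the guard and the list of new labels depend on it.
      choose : ∀ b → truthy (eval (orE (hd (var row)) (equalE (var rU) (var rV))) start) ≡ b →
               let new = if b then List.map (pr u v) (downFrom M) else [] in
               mag (listOf item (new ʳ++ ℓs)) ⊑ 64 →
               Run chooseCell start (stage₂ x rs (pair (bitOf u v) r) (toℕ u) (toℕ v) 0 (new ʳ++ ℓs))
      choose true  guard fits = Run-then guard
        (Run-assign rC _ refl (≤X⇒fits M≤X) ⨾ᴿ
         Run-while (copies-rounds u v M ℓs ≤-refl fits) (≤X⇒⊑4 M≤X))
      choose false guard _    = Run-else guard Run-skip

    cell-rounds : ∀ {x rs} u vs j ℓs → Upwards j vs → j + length vs ≤ n → mag (listOf (bitOf u) vs) ⊑ 7 →
                  mag (listOf item (concatMap (cell u) vs ʳ++ ℓs)) ⊑ 64 →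
                  Rounds (isPair (var row)) nextCell (length vs)
                    (stage₂ x rs (listOf (bitOf u) vs) (toℕ u) j 0 ℓs)
                    (stage₂ x rs nil (toℕ u) (j + length vs) 0 (concatMap (cell u) vs ʳ++ ℓs))
    cell-rounds u []       j ℓs [] _ _ _ rewrite +-identityʳ j = done refl
    cell-rounds {x} {rs} u (v ∷ vs) _ ℓs (refl ∷ up) j+≤n row-fits fits = more refl
      (run-chooseCell u v ℓs (suffix-fits (concatMap (cell u) vs) fits′) ⨾ᴿ
       Run-assign row _ refl (tail-fits {bitOf u v} row-fits) ⨾ᴿ
       Run-assign rV _ refl (≤X⇒fits (≤-trans (≤-trans (s≤s (m≤m+n (toℕ v) _)) suc≤) n≤X)))
      (Rounds-end (cong₂ (λ j → stage₂ x rs nil (toℕ u) j 0)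
          (sym (+-suc (toℕ v) (length vs))) (sym (List.++-ʳ++ (cell u v))))
        (cell-rounds u vs (suc (toℕ v)) (cell u v ʳ++ ℓs) up suc≤ (tail-fits {bitOf u v} row-fits) fits′))
      where
      suc≤ : suc (toℕ v) + length vs ≤ n
      suc≤ = ≤-trans (≤-reflexive (sym (+-suc (toℕ v) (length vs)))) j+≤n

      fits′ : mag (listOf item (concatMap (cell u) vs ʳ++ (cell u v ʳ++ ℓs))) ⊑ 64
      fits′ = subst (λ ℓs → mag (listOf item ℓs) ⊑ 64) (List.++-ʳ++ (cell u v)) fits

    length-allFin : length (allFin n) ≡ n
    length-allFin = List.length-tabulate id

    row-rounds : ∀ {x} us j ℓs → Upwards j us → j + length us ≤ n → mag (listOf rowOf us) ⊑ 7 →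
                 mag (listOf item (concatMap cells us ʳ++ ℓs)) ⊑ 64 →
                 Rounds (isPair (var rows)) nextRow (length us)
                   (stage₂ x (listOf rowOf us) nil j 0 0 ℓs)
                   (stage₂ x nil nil (j + length us) 0 0 (concatMap cells us ʳ++ ℓs))
    row-rounds []       j ℓs [] _ _ _ rewrite +-identityʳ j = done refl
    row-rounds {x} (u ∷ us) _ ℓs (refl ∷ up) j+≤n rows-fit fits = more refl
      (Run-assign row _ refl (head-fits rows-fit) ⨾ᴿ
       Run-assign acc _ (cong (λ i → pair i (listOf item ℓs)) (eval-vertItem u holds₂))
         (suffix-fits (concatMap (cell u) (allFin n)) (suffix-fits (concatMap cells us) fits′)) ⨾ᴿ
       Run-while (cell-rounds u (allFin n) 0 (vert u ∷ ℓs) (upwards-allFin n) (≤-reflexive length-allFin)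
           (head-fits rows-fit) (suffix-fits (concatMap cells us) fits′))
         (≤X⇒⊑4 (≤-trans (≤-reflexive length-allFin) n≤X)) ⨾ᴿ
       Run-assign rV _ refl nil-fits ⨾ᴿ
       Run-assign rows _ refl (tail-fits rows-fit) ⨾ᴿ
       Run-assign rU _ refl (≤X⇒fits (≤-trans (≤-trans (s≤s (m≤m+n (toℕ u) _)) suc≤) n≤X)))
      (Rounds-end (cong₂ (λ j → stage₂ x nil nil j 0 0)
          (sym (+-suc (toℕ u) (length us))) (sym (List.++-ʳ++ (cells u))))
        (row-rounds us (suc (toℕ u)) (cells u ʳ++ ℓs) up suc≤ (tail-fits rows-fit) fits′))
      where
      suc≤ : suc (toℕ u) + length us ≤ n
      suc≤ = ≤-trans (≤-reflexive (sym (+-suc (toℕ u) (length us)))) j+≤n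

      fits′ : mag (listOf item (concatMap cells us ʳ++ (cells u ʳ++ ℓs))) ⊑ 64
      fits′ = subst (λ ℓs → mag (listOf item ℓs) ⊑ 64) (List.++-ʳ++ (cells u)) fits

    adjacency : Label n → Label n → Val
    adjacency ℓ ℓ′ = fromBool (adjacentᵇ ℓ ℓ′)

    repOf : Label n → Val
    repOf ℓ = encodeRep (placeOf ℓ)

    says-adjacent : ∀ {x ra ma re ℓs os is} ℓ ℓ′ →
                    Says (stage₃ x (pair (item ℓ) os) (pair (item ℓ′) is) ra ma re ℓs) adjacentE (adjacentᵇ ℓ ℓ′)
    says-adjacent ℓ ℓ′ = says-and
      (says-polar co (meetsE-correct (placeOf ℓ) (placeOf ℓ′) refl refl))
      (says-not (says-equal (denotes refl) (denotes refl)))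

    bit-rounds : ∀ {x os ma re ℓs} ℓ is ds → mag (listOf item is) ⊑ 64 →
                 mag (listOf (adjacency ℓ) (is ʳ++ ds)) ⊑ 10 →
                 Rounds (isPair (var inner)) nextBit (length is)
                   (stage₃ x (pair (item ℓ) os) (listOf item is) (listOf (adjacency ℓ) ds) ma re ℓs)
                   (stage₃ x (pair (item ℓ) os) nil (listOf (adjacency ℓ) (is ʳ++ ds)) ma re ℓs)
    bit-rounds ℓ []       ds _ _ = done refl
    bit-rounds ℓ (i ∷ is) ds is-fit fits = more refl
      (Run-assign rowAcc _ (cong (λ b → pair b (listOf (adjacency ℓ) ds)) (truth (says-adjacent ℓ i)))
         (suffix-fits is fits) ⨾ᴿ
       Run-assign inner _ refl (tail-fits {item i} is-fit))
      (bit-rounds ℓ is (i ∷ ds) (tail-fits {item i} is-fit) fits)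

    module _ {ℓs : List (Label n)} (ℓs-short : length ℓs ⊑ 4) (ℓs-fit : mag (listOf item ℓs) ⊑ 64)
             (line-fits : ∀ ℓ → mag (listOf (adjacency ℓ) (ℓs ʳ++ [])) ⊑ 10) where

      lineOf : Label n → Val
      lineOf ℓ = listOf (adjacency ℓ) (ℓs ʳ++ [])

      line-rounds : ∀ {x} os ds → mag (listOf item os) ⊑ 64 → mag (listOf lineOf (os ʳ++ ds)) ⊑ 20 →
                    mag (listOf repOf (os ʳ++ ds)) ⊑ 64 →
                    Rounds (isPair (var outer)) nextLine (length os)
                      (stage₃ x (listOf item os) nil nil (listOf lineOf ds) (listOf repOf ds) ℓs)
                      (stage₃ x nil nil nil (listOf lineOf (os ʳ++ ds)) (listOf repOf (os ʳ++ ds)) ℓs)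
      line-rounds []       ds _ _ _ = done refl
      line-rounds (ℓ ∷ os) ds os-fit lines-fit reps-fit = more refl
        (Run-assign inner _ refl ℓs-fit ⨾ᴿ
         Run-while (bit-rounds ℓ ℓs [] ℓs-fit (line-fits ℓ)) ℓs-short ⨾ᴿ
         Run-assign matAcc _ refl (suffix-fits os lines-fit) ⨾ᴿ
         Run-assign rowAcc _ refl nil-fits ⨾ᴿ
         Run-assign repAcc _ refl (suffix-fits os reps-fit) ⨾ᴿ
         Run-assign outer _ refl (tail-fits {item ℓ} os-fit))
        (line-rounds os (ℓ ∷ ds) (tail-fits {item ℓ} os-fit) lines-fit reps-fit)

    -- A store built only for estimation: an item is the value of its expression there, so
    -- `mag-eval` bounds it without any separate arithmetic on placements.
    probe-fits : ∀ {u v c} → u ≤ X → v ≤ X → c ≤ X → Fits (stage₂ nil nil nil u v c [])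
    probe-fits {u} {v} {c} u≤ v≤ c≤ = Pointwise.lookup pointwise
      where
      pointwise : Pointwise.Pointwise (λ v b → mag v ⊑ b) (stage₂ nil nil nil u v c []) exponents
      pointwise =
        nil-fits ∷ nil-fits ∷ nil-fits ∷ ≤X⇒fits n≤X ∷ ≤X⇒fits M≤X ∷ ≤X⇒fits u≤ ∷ ≤X⇒fits v≤ ∷ ≤X⇒fits c≤ ∷
        nil-fits ∷ nil-fits ∷ nil-fits ∷ nil-fits ∷ nil-fits ∷ nil-fits ∷ []

    item-fits : ∀ ℓ → Valid G M ℓ → mag (item ℓ) ⊑ 50
    item-fits (vert u)   _        = subst (λ v → mag v ⊑ 50) (eval-vertItem u holds₂)
      (⊑-raise vertItemE-small
        (mag-eval (probe-fits (≤-trans (<⇒≤ (toℕ<n u)) n≤X) z≤n z≤n) vertItemE))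
    item-fits (pr u v c) (_ , c<) = subst (λ v → mag v ⊑ 50) (eval-prItem u v holds₂)
      (⊑-raise prItemE-small
        (mag-eval (probe-fits (≤-trans (<⇒≤ (toℕ<n u)) n≤X) (≤-trans (<⇒≤ (toℕ<n v)) n≤X)
          (≤-trans (<⇒≤ c<) M≤X)) prItemE))

    items-fit : All (λ ℓ → mag (item ℓ) ⊑ 50) labels
    items-fit = All.tabulate (λ {ℓ} ℓ∈ → item-fits ℓ (labels-valid ℓ∈))

    -- There are at most n * (1 + n * M) labels. This is the source of the exponent 4 that bounds
    -- the rounds of every loop.
    labels-short : length labels ⊑ 4
    labels-short = ⊑-trans (length-concatMap (allFin n) cells≤)
      (⊑-product (≤X⇒⊑1 (≤-trans (≤-reflexive length-allFin) n≤X))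
        (⊑-suc (⊑-product (≤X⇒⊑1 n≤X) (≤X⇒⊑1 M≤X))))
      where
      cell≤ : ∀ u v → length (cell u v) ≤ M
      cell≤ u v with linked G u v
      ... | true  = ≤-reflexive (trans (List.length-map (pr u v) (downFrom M)) (List.length-downFrom M))
      ... | false = z≤n

      cells≤ : ∀ u → length (cells u) ≤ suc (n * M)
      cells≤ u = s≤s (≤-trans (length-concatMap (allFin n) (cell≤ u))
        (*-monoˡ-≤ M (≤-reflexive length-allFin)))

    -- The order in which the items are collected; scanning them collects the
    -- lines and representations in the order of labels again.
    reversed : List (Label n)
    reversed = labels ʳ++ []

    reversed-reversed : reversed ʳ++ [] ≡ labels
    reversed-reversed = trans (List.ʳ++-ʳ++ labels) (List.++-identityʳ labels)

    reversed-short : length reversed ⊑ 4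
    reversed-short = ⊑-trans (≤-reflexive (trans (List.length-ʳ++ labels) (+-identityʳ _))) labels-short

    fromBool-fits : ∀ b → mag (fromBool b) ⊑ 1
    fromBool-fits b = ⊑-trans (mag-fromBool b) 2⊑1

    lines-fit : ∀ ℓ → mag (listOf (adjacency ℓ) labels) ⊑ 7
    lines-fit ℓ = listOf-fits (All.universal (λ ℓ′ → fromBool-fits (adjacentᵇ ℓ ℓ′)) labels) labels-short

    output-matrix output-family : Val
    output-matrix = listOf (λ ℓ → listOf (adjacency ℓ) labels) labels
    output-family = listOf repOf labels

    output-matrix-fits : mag output-matrix ⊑ 13
    output-matrix-fits = listOf-fits (All.universal lines-fit labels) labels-short

    output-family-fits : mag output-family ⊑ 56
    output-family-fits = ⊑-raise (≤ᵇ⇒≤ _ _ tt)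
      (listOf-fits (All.map (λ {ℓ} → tail-fits {int (ℤ.+ keyOf ℓ)}) items-fit) labels-short)

    input output : Val
    input  = pair (encodeGraph G) (int (ℤ.+ k))
    output = pair output-matrix (pair output-family (pair (int (ℤ.+ k)) (int (ℤ.+ (k * (k * M))))))

    k≤X : k ≤ X
    k≤X = ≤-trans (m≤n+m k 2) M≤X

    rows-fit : mag (listOf rowOf (allFin n)) ⊑ 7
    rows-fit = ⊑-raise (≤ᵇ⇒≤ _ _ tt) (listOf-fits
      (All.universal (λ u → listOf-fits
        (All.universal (λ v → fromBool-fits (Graph.adj G u v)) (allFin n)) size⊑1) (allFin n))
      size⊑1)
      where
      size⊑1 : length (allFin n) ⊑ 1
      size⊑1 = ≤X⇒⊑1 (≤-trans (≤-reflexive length-allFin) n≤X)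

    input-fits : mag input ⊑ 100
    input-fits = ⊑-raise (≤ᵇ⇒≤ _ _ tt)
      (⊑-suc (⊑-sum (subst (λ v → mag v ⊑ 7) (sym matrix≡) rows-fit) (≤X⇒fits k≤X)))

    output-fits : mag output ⊑ 100
    output-fits = ⊑-raise (≤ᵇ⇒≤ _ _ tt)
      (⊑-suc (⊑-sum output-matrix-fits (⊑-suc (⊑-sum output-family-fits (⊑-suc (⊑-sum (≤X⇒fits k≤X)
        (⊑-suc (⊑-product (≤X⇒⊑1 k≤X) (⊑-product (≤X⇒⊑1 k≤X) (≤X⇒⊑1 M≤X))))))))))

    few : length (allFin n) ⊑ 4
    few = ≤X⇒⊑4 (≤-trans (≤-reflexive length-allFin) n≤X)

    reversed-fits : mag (listOf item reversed) ⊑ 64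
    reversed-fits = ⊑-raise (≤ᵇ⇒≤ _ _ tt) (listOf-fits (All-ʳ++ items-fit []) reversed-short)

    before final : Store registers
    before = stage₃ input nil nil nil output-matrix output-family reversed
    final  = stage₃ output nil nil nil output-matrix output-family reversed

    run-count : ∀ {x} → Run (while (isPair (var rows)) count)
                 (stage₁ x (listOf rowOf (allFin n)) 0) (stage₁ x nil n)
    run-count {x} = Run-while (Rounds-end (cong (stage₁ x nil) length-allFin)
      (count-rounds (allFin n) 0 (upwards-allFin n) (≤-reflexive length-allFin) rows-fit)) few

    run-rows : ∀ {x} → Run (while (isPair (var rows)) nextRow)
                 (stage₂ x (listOf rowOf (allFin n)) nil 0 0 0 []) (stage₂ x nil nil n 0 0 reversed)
    run-rows {x} = Run-while (Rounds-end (cong (λ j → stage₂ x nil nil j 0 0 reversed) length-allFin)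
      (row-rounds (allFin n) 0 [] (upwards-allFin n) (≤-reflexive length-allFin) rows-fit reversed-fits)) few

    reread : ∀ {f : List (Label n) → Val} {b c} → b ≤ c → mag (f labels) ⊑ b → mag (f (reversed ʳ++ [])) ⊑ c
    reread {f} {b} {c} b≤c p = subst (λ ℓs → mag (f ℓs) ⊑ c) (sym reversed-reversed) (⊑-raise b≤c p)

    run-lines : ∀ {x} → Run (while (isPair (var outer)) nextLine)
                  (stage₃ x (listOf item reversed) nil nil nil nil reversed)
                  (stage₃ x nil nil nil output-matrix output-family reversed)
    run-lines {x} = Run-while (Rounds-end
      (cong (λ ℓs → stage₃ x nil nil nil (listOf (λ ℓ → listOf (adjacency ℓ) ℓs) ℓs) (listOf repOf ℓs) reversed)
        reversed-reversed)
      (line-rounds reversed-short reversed-fits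
        (λ ℓ → reread {listOf (adjacency ℓ)} (≤ᵇ⇒≤ _ _ tt) (lines-fit ℓ)) reversed [] reversed-fits
        (reread {λ ℓs → listOf (λ ℓ → listOf (adjacency ℓ) ℓs) ℓs} (≤ᵇ⇒≤ _ _ tt) output-matrix-fits)
        (reread {listOf repOf} (≤ᵇ⇒≤ _ _ tt) output-family-fits))) reversed-short

    run-output : Run (io := cons (var matAcc) (cons (var repAcc)
                       (cons (tl (var io)) (mul (tl (var io)) (mul (tl (var io)) (var rM)))))) before final
    run-output = Run-assign io _ (cong (λ l → pair output-matrix (pair output-family (pair (int (ℤ.+ k)) l)))
      (value (denotes-mul {s = before} {tl (var io)} {mul (tl (var io)) (var rM)} (denotes refl)
        (denotes-mul {d = tl (var io)} {var rM} (denotes refl) (denotes refl)))))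
      output-fits

    main-run : Run main (stage₁ input nil 0) final
    main-run =
      Run-assign {s = stage₁ input nil 0} rows (hd (var io)) matrix≡ rows-fit ⨾ᴿ
      run-count ⨾ᴿ
      Run-assign {s = stage₁ input nil n} rM (add (lit (ℤ.+ 2)) (tl (var io))) {int (ℤ.+ M)} refl (≤X⇒fits M≤X) ⨾ᴿ
      Run-assign {s = stage₁ input nil n Vec.[ rM ]≔ int (ℤ.+ M)} rows (hd (var io)) matrix≡ rows-fit ⨾ᴿ
      run-rows ⨾ᴿ
      Run-assign {s = stage₂ input nil nil n 0 0 reversed} outer (var acc) {listOf item reversed}
        refl reversed-fits ⨾ᴿ
      run-lines ⨾ᴿ
      run-output

    initial-fits : Fits (stage₁ input nil 0)
    initial-fits zero    = input-fits
    initial-fits (suc x) = subst (λ v → mag v ⊑ lookup exponents (suc x)) (sym (lookup-replicate x nil)) nil-fits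

    main-runs : ∃ λ t → Runs program input output t × t ⊑ main-time
    main-runs = subst (λ a → ∃ λ t → Runs program input output t × t ⊑ a) (sym main-time-unfold)
      (let t , exec , t⊑ = proj₂ (main-run .proof initial-fits) in t , (Vec.tail final , exec) , t⊑)

-- The reduction

computable : ∀ {p} {f : Vec ℕ p → ℕ} (e : Expr 1) →
             (∀ v → Denotes (encodeParams v ∷ []) e (f v)) → Computable f
computable e correct =
  record { extra = 0 ; code = zero := e } ,
  λ v → suc (cost e (encodeParams v ∷ [])) , [] ,
    subst (λ y → Exec (zero := e) (encodeParams v ∷ []) (y ∷ []) (suc (cost e (encodeParams v ∷ []))))
      (value (correct v)) (assign zero e)

^-distribʳ-* : ∀ a m n → (m * n) ^ a ≡ m ^ a * n ^ a
^-distribʳ-* zero    m n = refl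
^-distribʳ-* (suc a) m n = trans (cong (m * n *_) (^-distribʳ-* a m n))
  ([m*n]*[o*p]≡[m*o]*[n*p] m n (m ^ a) (n ^ a))

powE : ∀ {m} → Expr m → ℕ → Expr m
powE e zero    = lit (ℤ.+ 1)
powE e (suc a) = mul e (powE e a)

denotes-pow : ∀ {m} {s : Store m} {e b} → Denotes s e b → ∀ a → Denotes s (powE e a) (b ^ a)
denotes-pow p zero    = denotes-lit
denotes-pow p (suc a) = denotes-mul p (denotes-pow p a)

length≤size : ∀ {A : Set} (f : A → Val) xs → List.length xs ≤ size (listOf f xs)
length≤size f []       = z≤n
length≤size f (x ∷ xs) = s≤s (≤-trans (length≤size f xs) (m≤n+m _ (size (f x))))

vertices≤size : ∀ {n} (G : Graph n) → n ≤ size (encodeGraph G)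
vertices≤size {n} G = begin
  n                                     ≡⟨ List.length-tabulate {n = n} id ⟨
  List.length (List.tabulate {n = n} id) ≤⟨ length≤size _ (List.tabulate id) ⟩
  size (listOf _ (List.tabulate id))    ≡⟨ cong size (encodeFamily-tabulate _ id) ⟨
  size (encodeGraph G)                  ∎

module _ (D : Drawing) (φ : ∀ {n} → Graph n → Graph n)
         (φ-adjacent : ∀ {N} (H : Graph N) {x y} {P : Set} → x ≢ y → Dec P →
                       Adjacent H x y ⇔ Joined (Drawing.co D) P → Adjacent (φ H) x y ⇔ P) where

  open Drawing D using (tracks)
  open Reducer D
  open CliqueInstance

  module Cut (x : CliqueInstance) = Cutting D (graph x) (k x)

  cutInstance : CliqueInstance → CutInstance tracks φ
  cutInstance x = record
    { H = Cut.H x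
    ; representation = record
      { family     = Cut.family x
      ; balanced   = λ v → intervals-balanced (Cut.placeOf x (Cut.label x v))
                             (Cut.placeOf-positive x (Cut.label x v))
      ; represents = λ u v u≢v → φ-adjacent (Cut.H x) u≢v (Cut.intersect? x u v) (Cut.adjacent⇔Intersect x u≢v)
      }
    ; k = k x
    ; l = k x * (k x * Cut.M x)
    }

  module _ (x : CliqueInstance) where

    open Powers._⊑_

    private
      inputSize = size (ParameterizedProblem.encode k-Clique x)
      -- A product, so that a power of `X` splits into a function of the parameter and a power of
      -- the input size.
      X = (2 + k x) * inputSize

    M≤X : 2 + k x ≤ X
    M≤X = m≤m*n (2 + k x) inputSize

    n≤X : n x ≤ X
    n≤X = begin
      n x                          ≤⟨ vertices≤size (graph x) ⟩
      size (encodeGraph (graph x)) ≤⟨ m≤n⇒m≤1+n (m≤m+n _ _) ⟩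
      inputSize                            ≤⟨ m≤n*m inputSize (2 + k x) ⟩
      X                            ∎

    2≤X : 2 ≤ X
    2≤X = ≤-trans (s≤s (s≤s z≤n)) M≤X

    output≡ : output (graph x) (k x) X 2≤X n≤X M≤X ≡
              ParameterizedProblem.encode (CuttingVia tracks φ) (cutInstance x)
    output≡ = cong₂ (λ u v → pair u (pair v (pair (int (ℤ.+ k x)) (int (ℤ.+ (k x * (k x * Cut.M x)))))))
      (sym matrix≡′) (sym (encodeFamily-lookup (encodeRep ∘ Cut.placeOf x) (Cut.labels x)))
      where
      adjacency′ : Label (n x) → Label (n x) → Val
      adjacency′ ℓ ℓ′ = fromBool (Cut.adjacentᵇ x ℓ ℓ′)

      matrix≡′ : encodeGraph (Cut.H x) ≡ listOf (λ ℓ → listOf (adjacency′ ℓ) (Cut.labels x)) (Cut.labels x)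
      matrix≡′ = trans
        (encodeFamily-lookup (λ ℓ → encodeFamily (adjacency′ ℓ ∘ Cut.label x)) (Cut.labels x))
        (listOf-cong (λ ℓ → encodeFamily-lookup (adjacency′ ℓ) (Cut.labels x)) (Cut.labels x))

    reduction-runs : ∃ λ t → Runs program (ParameterizedProblem.encode k-Clique x)
                       (ParameterizedProblem.encode (CuttingVia tracks φ) (cutInstance x)) t ×
                     t ≤ (2 + k x) ^ main-time * inputSize ^ main-time
    reduction-runs = subst
      (λ y → ∃ λ t → Runs program (ParameterizedProblem.encode k-Clique x) y t ×
                     t ≤ (2 + k x) ^ main-time * inputSize ^ main-time) output≡
      (let t , exec , t⊑ = main-runs (graph x) (k x) X 2≤X n≤X M≤X in
       t , exec , ≤-trans (bound t⊑) (≤-reflexive (^-distribʳ-* main-time (2 + k x) inputSize)))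

  reduction : W[1]-Hard (CuttingVia tracks φ)
  reduction = record
    { map      = cutInstance
    ; correct  = λ x → CliqueVersusCut.clique⇔cut (graph x) (k x) (Cut.H x) (Cut.label x) (Cut.isCutGraph x)
    ; program  = program
    ; g        = λ v → (2 + Vec.head v) ^ main-time
    ; g-comp   = computable (powE (add (lit (ℤ.+ 2)) (hd (var zero))) (main-time))
        λ { (a ∷ []) → denotes-pow (denotes-add denotes-lit (denotes refl)) (main-time) }
    ; exponent = main-time
    ; runs     = reduction-runs
    -- The sum of both new parameters, k and l = k * (k * (2 + k)), so it bounds each of them.
    ; h        = λ v → let a = Vec.head v in a + a * (a * (2 + a))
    ; h-comp   = computable
        (add (hd (var zero)) (mul (hd (var zero)) (mul (hd (var zero)) (add (lit (ℤ.+ 2)) (hd (var zero))))))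
        λ { (a ∷ []) → denotes-add (denotes refl) (denotes-mul (denotes refl)
              (denotes-mul (denotes refl) (denotes-add denotes-lit (denotes refl)))) }
    ; bounded  = λ { x zero → m≤m+n (k x) _ ; x (suc zero) → m≤n+m _ (k x) }
    }

theorem15 : W[1]-Hard (CuttingOnBalanced 2) × W[1]-Hard (CuttingOnCoBalanced 3)
theorem15 =
  reduction drawing₂ id (λ _ _ _ adj⇔ → adj⇔) ,
  reduction drawing₃ complement (λ H x≢y P? adj⇔ → ⇔.trans (complement-adjacent⇔ H x≢y)
    (mk⇔ (λ ¬adj → decidable-stable P? (¬adj ∘ from adj⇔)) (λ p adj → to adj⇔ adj p)))
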